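{- Let $\mathcal{A}$ be a universal, refinable axiomatic semantics that satisfies extensibility, over a given finite set of cores $\mathsf{Cores}$ and stages $\mathsf{Stages}$, and let $t\ge1$. Then synthesis of a finite-state, bounded-history operational model that is sound and $t$-complete with respect to $\mathcal{A}$ is feasible: one can construct an operational model $\mathcal{M}=(\mathcal{Q},\Delta,q_{\mathsf{init}},q_{\mathsf{final}})$ with $\mathcal{Q}$ finite and history parameter $h\in\mathbb{N}$ that is sound and $t$-complete w.r.t. $\mathcal{A}$.
   Context: Programming model: cores $\mathsf{Cores}=[n]$; finite operation set $\mathbb{O}$; a program $\mathcal{P}$ is a family of instruction streams $\mathcal{I}_c\in\mathbb{O}^*$; instructions $(c,j,\mathcal{I}_c[j])$ have core $c$, label $j$; events $i.\mathsf{st}$; $\mathsf{Events}(\mathcal{P})$ the events of $\mathcal{P}$. $\mu$spec axioms are first-order sentences quantifying over instructions (distinct variables get distinct instructions), built from atoms $i_1<_r i_2$ (same core, smaller label), predicates $\mathsf{P}(i_1,\ldots)$ (interpreted by fixed relations on operations), and $\mathsf{hb}(i_1.\mathsf{st}_1,i_2.\mathsf{st}_2)$. A $\mu$hb graph for $\mathcal{P}$ is a DAG $G=(V,E)$ with $V=\mathsf{Events}(\mathcal{P})$, where $\mathsf{hb}$ is interpreted by $E^+$; $G\models_{\mathcal{P}}\mathcal{A}$ means all axioms hold. Universal: every axiom has the form $\forall i_1\cdots\forall i_k\,\phi$ with $\phi$ quantifier-free. Refinable: for every $\mathcal{P}$ and $G\models_{\mathcal{P}}\mathcal{A}$, every linear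 graph $G'$ on the same vertices with $E^+\subseteq E'^+$ satisfies $G'\models_{\mathcal{P}}\mathcal{A}$. Extensible: for all $\mathcal{P}'\preceq\mathcal{P}$ (each stream of $\mathcal{P}'$ a prefix of that of $\mathcal{P}$) with residual $\mathcal{P}''$ (the remaining suffixes), if $G'\models_{\mathcal{P}'}\textsc{ax}$ and $G''\models_{\mathcal{P}''}\textsc{ax}$ then $G'\triangleright G''\models_{\mathcal{P}}\textsc{ax}$ for every axiom, where $G'\triangleright G''$ is the disjoint union plus edges from every sink of $G'$ to every source of $G''$. Operational model: $(\mathcal{Q},\Delta,q_{\mathsf{init}},q_{\mathsf{final}})$ with history parameter $h$, reading each core's stream from a read-only one-way tape; transitions depend on the state and the symbols under the heads and either move a head right, do nothing, emit an event $i.\mathsf{st}$ for an instruction $i$ among those left of a head, or drop such an instruction; configurations with more than $h$ instructions left of some head are disallowed. $\mathsf{Traces}(\mathcal{M},\mathcal{P})$: sequences of emitted events of accepting runs (ending in the absorbing state $q_{\mathsf{final}}$), viewed as linear $\mu$hb graphs. Sound: for every $\mathcal{P}$, each trace in $\mathsf{Traces}(\mathcal{M},\mathcal{P})$ is a linearization of some $G\models_{\mathcal{P}}\mathcal{A}$. $t$-reordering bounded trace $\sigma$ (listing each event of $\mathcal{P}$ once): with $\mathsf{diff}_r(i_1,i_2)=\mathsf{label}(i_2)-\mathsf{label}(i_1)$, $\mathsf{start}/\mathsf{end}(i)$ the first/last index of an event of $i$, $\mathsf{pfxend}(i)=\max\{\mathsf{end}(i'):i'\le_r i\}$, and $\mathsf{coup}(i_1,i_2)$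 meaning $[\mathsf{start}(i_1),\mathsf{pfxend}(i_1)]$ and $[\mathsf{start}(i_2),\mathsf{pfxend}(i_2)]$ overlap: for all same-core $i_1,i_2$, (1) if an event of $i_2$ precedes an event of $i_1$ then $\mathsf{diff}_r(i_1,i_2)<t$, and (2) if $\mathsf{coup}(i_1,i),\mathsf{coup}(i,i_2)$ for some $i$ then $|\mathsf{diff}_r(i_1,i_2)|<t$. $t$-complete: for every $\mathcal{P}$ and $G\models_{\mathcal{P}}\mathcal{A}$, $\mathsf{Traces}(\mathcal{M},\mathcal{P})$ contains all $t$-reordering bounded linearizations of $G$. -}

module Defs where

open import Level using (0ℓ)
open import Data.Nat using (ℕ; zero; suc; _+_; _∸_; _≤_; _<_)
open import Data.Fin using (Fin; toℕ; fromℕ<) renaming (_≟_ to _≟ᶠ_)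
open import Data.Bool using (Bool; true; false; if_then_else_)
open import Data.Maybe using (Maybe; just; nothing)
open import Data.Product using (Σ; ∃; ∃₂; _×_; _,_; proj₁; proj₂)
open import Data.Sum using (_⊎_)
open import Data.Unit using (⊤)
open import Data.Empty using (⊥)
open import Data.List using (List; []; _∷_; _++_; length; drop; _∷ʳ_; lookup)
open import Data.List.Relation.Unary.All using (All)
open import Data.List.Relation.Unary.Unique.Propositional using (Unique)
open import Data.List.Membership.Propositional using (_∈_)
open import Data.Vec using (Vec) renaming (lookup to vlookup; map to vmap; _∷_ to _∷ᵥ_)
import Data.Vec.Relation.Unary.All as VAll
open import Relation.Binary using (Rel)
open import Relation.Binary.Construct.Closure.Transitive using (TransClosure)
open import Relation.Binary.PropositionalEquality using (_≡_; _≢_)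
open import Relation.Nullary using (¬_; does)

_!?_ : {A : Set} → List A → ℕ → Maybe A
[] !? _ = nothing
(x ∷ xs) !? zero = just x
(x ∷ xs) !? suc k = xs !? k

removeAt : {A : Set} → List A → ℕ → List A
removeAt [] _ = []
removeAt (x ∷ xs) zero = xs
removeAt (x ∷ xs) (suc k) = x ∷ removeAt xs k

At : {A : Set} → List A → ℕ → A → Set
At xs k x = xs !? k ≡ just x

module Semantics (n o s : ℕ) where

  Core  = Fin n
  Op    = Fin o
  Stage = Fin s

  Program : Set
  Program = Core → List Op

  RInstr : Set
  RInstr = Core × ℕ

  REvent : Set
  REvent = RInstr × Stage

  core : RInstr → Core
  core = proj₁

  label : RInstr → ℕ
  label = proj₂

  ValidI : Program → RInstr → Set
  ValidI P (c , j) = j < length (P c)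

  ValidE : Program → REvent → Set
  ValidE P (i , _) = ValidI P i

  Instr : Program → Set
  Instr P = Σ RInstr (ValidI P)

  opOf : (P : Program) → Instr P → Op
  opOf P ((c , j) , v) = lookup (P c) (fromℕ< v)

  -- μspec formulas (de Bruijn: Formula k has k instruction variables)
  data Formula (k : ℕ) : Set where
    tt ff  : Formula k
    po     : Fin k → Fin k → Formula k
    pred   : (m : ℕ) → (Vec Op m → Bool) → Vec (Fin k) m → Formula k
    hb     : Fin k → Stage → Fin k → Stage → Formula k
    ¬'_    : Formula k → Formula k
    _∧'_ _∨'_ _⇒'_ : Formula k → Formula k → Formula k
    all' ex' : Formula (suc k) → Formula k

  data QF {k : ℕ} : Formula k → Set where
    qf-tt : QF tt
    qf-ff : QF ff
    qf-po : ∀ {x y} → QF (po x y)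
    qf-pred : ∀ {m f xs} → QF (pred m f xs)
    qf-hb : ∀ {x a y b} → QF (hb x a y b)
    qf-¬ : ∀ {φ} → QF φ → QF (¬' φ)
    qf-∧ : ∀ {φ ψ} → QF φ → QF ψ → QF (φ ∧' ψ)
    qf-∨ : ∀ {φ ψ} → QF φ → QF ψ → QF (φ ∨' ψ)
    qf-⇒ : ∀ {φ ψ} → QF φ → QF ψ → QF (φ ⇒' ψ)

  data UniversalF {k : ℕ} : Formula k → Set where
    u-qf  : ∀ {φ} → QF φ → UniversalF φ
    u-all : ∀ {φ} → UniversalF φ → UniversalF (all' φ)

  Axioms : Set
  Axioms = List (Formula 0)

  Universal : Axioms → Set
  Universal A = All UniversalF A

  Graph : Set₁
  Graph = Rel REvent 0ℓ

  hbRel : Graph → Rel REvent 0ℓ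
  hbRel E = TransClosure E

  IsμhbGraph : Program → Graph → Set
  IsμhbGraph P E =
    (∀ e₁ e₂ → E e₁ e₂ → ValidE P e₁ × ValidE P e₂)
    × (∀ e → ¬ hbRel E e e)

  -- variables denote pairwise distinct instructions
  Fresh : {P : Program} {k : ℕ} → Instr P → Vec (Instr P) k → Set
  Fresh i ρ = VAll.All (λ i' → proj₁ i' ≢ proj₁ i) ρ

  Sat : (P : Program) → Graph → {k : ℕ} → Vec (Instr P) k → Formula k → Set
  Sat P E ρ tt = ⊤
  Sat P E ρ ff = ⊥
  Sat P E ρ (po x y) =
    core (proj₁ (vlookup ρ x)) ≡ core (proj₁ (vlookup ρ y))
    × label (proj₁ (vlookup ρ x)) < label (proj₁ (vlookup ρ y))
  Sat P E ρ (pred m f xs) = f (vmap (λ x → opOf P (vlookup ρ x)) xs) ≡ true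
  Sat P E ρ (hb x a y b) =
    hbRel E (proj₁ (vlookup ρ x) , a) (proj₁ (vlookup ρ y) , b)
  Sat P E ρ (¬' φ) = ¬ Sat P E ρ φ
  Sat P E ρ (φ ∧' ψ) = Sat P E ρ φ × Sat P E ρ ψ
  Sat P E ρ (φ ∨' ψ) = Sat P E ρ φ ⊎ Sat P E ρ ψ
  Sat P E ρ (φ ⇒' ψ) = Sat P E ρ φ → Sat P E ρ ψ
  Sat P E ρ (all' φ) = (i : Instr P) → Fresh {P} i ρ → Sat P E (i ∷ᵥ ρ) φ
  Sat P E ρ (ex' φ) = Σ (Instr P) λ i → Fresh {P} i ρ × Sat P E (i ∷ᵥ ρ) φ

  SatAx : Program → Graph → Formula 0 → Set
  SatAx P E ax = Sat P E Data.Vec.[] ax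

  Models : Program → Graph → Axioms → Set
  Models P E A = All (SatAx P E) A

  Lin : List REvent → Graph
  Lin σ e₁ e₂ = ∃₂ λ xs ys → σ ≡ xs ++ e₁ ∷ e₂ ∷ ys

  ListsEvents : Program → List REvent → Set
  ListsEvents P σ = Unique σ × All (ValidE P) σ × (∀ e → ValidE P e → e ∈ σ)

  Linearization : Program → List REvent → Graph → Set
  Linearization P σ E =
    ListsEvents P σ × (∀ e₁ e₂ → hbRel E e₁ e₂ → hbRel (Lin σ) e₁ e₂)

  Refinable : Axioms → Set₁
  Refinable A =
    ∀ (P : Program) (E : Graph) → IsμhbGraph P E → Models P E A →
    ∀ (σ : List REvent) → Linearization P σ E → Models P (Lin σ) A

  _⪯_ : Program → Program → Set
  P' ⪯ P = ∀ c → ∃ λ r → P c ≡ P' c ++ r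

  residual : Program → Program → Program
  residual P P' c = drop (length (P' c)) (P c)

  -- event of P (in the suffix part) seen as an event of the residual
  unshift : Program → REvent → REvent
  unshift P' ((c , j) , st) = ((c , j ∸ length (P' c)) , st)

  inSuffix : Program → REvent → Set
  inSuffix P' ((c , j) , _) = length (P' c) ≤ j

  IsSink : Program → Graph → REvent → Set
  IsSink P E e = ValidE P e × (∀ e' → ¬ E e e')

  IsSource : Program → Graph → REvent → Set
  IsSource P E e = ValidE P e × (∀ e' → ¬ E e' e)

  -- G' ▷ G'' as a graph on Events(P), where P' ⪯ P and G'' lives on
  -- Events(residual P P'), embedded by shifting labels by length (P' c).
  ▷ : Program → Program → Graph → Graph → Graph
  ▷ P P' E' E'' e₁ e₂ =
    E' e₁ e₂
    ⊎ (inSuffix P' e₁ × inSuffix P' e₂ × E'' (unshift P' e₁) (unshift P' e₂))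
    ⊎ (IsSink P' E' e₁ × inSuffix P' e₂
        × IsSource (residual P P') E'' (unshift P' e₂))

  Extensible : Axioms → Set₁
  Extensible A =
    All (λ ax →
      ∀ (P P' : Program) → P' ⪯ P → ∀ (E' E'' : Graph) →
      IsμhbGraph P' E' → IsμhbGraph (residual P P') E'' →
      SatAx P' E' ax → SatAx (residual P P') E'' ax →
      SatAx P (▷ P P' E' E'') ax) A

  -- Operational models
  -- actions; instructions left of a head (and not dropped) are referred to
  -- by their position (< h) in the per-core window of retained instructions
  data Action (h : ℕ) : Set where
    move : Core → Action h
    nop  : Action h
    emit : Core → Fin h → Stage → Action h
    dropI : Core → Fin h → Action h

  -- symbols under the heads (nothing = end of tape)
  Heads : Set
  Heads = Core → Maybe Op

  record OpModel : Set where
    field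
      nQ     : ℕ
      h      : ℕ
      Δ      : Fin nQ → Heads → Action h → Fin nQ → Bool
      qinit  : Fin nQ
      qfinal : Fin nQ
      absorbing : ∀ r a q → Δ qfinal r a q ≡ true → q ≡ qfinal

  upd : {A : Set} → (Core → A) → Core → (A → A) → Core → A
  upd f c g c' = if does (c' ≟ᶠ c) then g (f c') else f c'

  module Run (M : OpModel) (P : Program) where
    open OpModel M

    record Config : Set where
      constructor cfg
      field
        state : Fin nQ
        pos   : Core → ℕ
        ret   : Core → List ℕ     -- labels left of head, not dropped

    open Config

    heads : Config → Heads
    heads C c = P c !? pos C c

    init : Config
    init = cfg qinit (λ _ → 0) (λ _ → [])

    data Step : Config → Maybe REvent → Config → Set where
      st-move : ∀ {q ps rs} c q' → Δ q (heads (cfg q ps rs)) (move c) q' ≡ true →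
        ps c < length (P c) → suc (length (rs c)) ≤ h →
        Step (cfg q ps rs) nothing
             (cfg q' (upd ps c suc) (upd rs c (λ l → l ∷ʳ ps c)))
      st-nop : ∀ {q ps rs} q' → Δ q (heads (cfg q ps rs)) nop q' ≡ true →
        Step (cfg q ps rs) nothing (cfg q' ps rs)
      st-emit : ∀ {q ps rs} c k st j q' →
        Δ q (heads (cfg q ps rs)) (emit c k st) q' ≡ true →
        At (rs c) (toℕ k) j →
        Step (cfg q ps rs) (just ((c , j) , st)) (cfg q' ps rs)
      st-drop : ∀ {q ps rs} c k j q' →
        Δ q (heads (cfg q ps rs)) (dropI c k) q' ≡ true →
        At (rs c) (toℕ k) j →
        Step (cfg q ps rs) nothing
             (cfg q' ps (upd rs c (λ l → removeAt l (toℕ k))))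

    data Steps : Config → List REvent → Config → Set where
      done : ∀ {C} → Steps C [] C
      silent : ∀ {C C' C'' σ} → Step C nothing C' → Steps C' σ C'' → Steps C σ C''
      emitted : ∀ {C C' C'' e σ} → Step C (just e) C' → Steps C' σ C'' →
        Steps C (e ∷ σ) C''

    IsTrace : List REvent → Set
    IsTrace σ = ∃ λ C → Steps init σ C × state C ≡ qfinal

  Traces : OpModel → Program → List REvent → Set
  Traces M P = Run.IsTrace M P

  Sound : OpModel → Axioms → Set₁
  Sound M A = ∀ (P : Program) (σ : List REvent) → Traces M P σ →
    Σ Graph λ E → IsμhbGraph P E × Models P E A × Linearization P σ E

  EvAt : List REvent → ℕ → RInstr → Set
  EvAt σ k i = ∃ λ st → At σ k (i , st)

  IsStart : List REvent → RInstr → ℕ → Set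
  IsStart σ i k = EvAt σ k i × (∀ k' → EvAt σ k' i → k ≤ k')

  IsPfxEnd : List REvent → RInstr → ℕ → Set
  IsPfxEnd σ i k =
    (∃ λ i' → core i' ≡ core i × label i' ≤ label i × EvAt σ k i')
    × (∀ i' k' → core i' ≡ core i → label i' ≤ label i → EvAt σ k' i' → k' ≤ k)

  Coup : List REvent → RInstr → RInstr → Set
  Coup σ i₁ i₂ = ∃₂ λ s₁ e₁ → ∃₂ λ s₂ e₂ →
    IsStart σ i₁ s₁ × IsPfxEnd σ i₁ e₁ × IsStart σ i₂ s₂ × IsPfxEnd σ i₂ e₂
    × s₁ ≤ e₂ × s₂ ≤ e₁

  ReorderingBounded : ℕ → Program → List REvent → Set
  ReorderingBounded t P σ =
    (∀ i₁ i₂ → ValidI P i₁ → ValidI P i₂ → core i₁ ≡ core i₂ →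
      ∀ k₁ k₂ → EvAt σ k₂ i₂ → EvAt σ k₁ i₁ → k₂ < k₁ →
      label i₂ < label i₁ + t)                      -- diff_r(i₁,i₂) < t
    × (∀ i₁ i₂ → ValidI P i₁ → ValidI P i₂ → core i₁ ≡ core i₂ →
      ∀ i → ValidI P i → Coup σ i₁ i → Coup σ i i₂ →
      label i₂ < label i₁ + t × label i₁ < label i₂ + t)  -- |diff_r| < t

  Complete : ℕ → OpModel → Axioms → Set₁
  Complete t M A = ∀ (P : Program) (E : Graph) → IsμhbGraph P E → Models P E A →
    ∀ (σ : List REvent) → Linearization P σ E → ReorderingBounded t P σ →
    Traces M P σ

{-# OPTIONS --safe #-}

-- By refinability it suffices to accept exactly those traces σ, among the ones executable with
-- windows of t instructions per core, for which Lin σ satisfies the axioms; and bound (1) on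
-- reordering says that every t-reordering bounded trace is executable with such windows.
-- Whether Lin σ satisfies a universal axiom is decided by a finite automaton built by induction
-- on the axiom, as in Büchi's theorem: the automaton reads the actions of the model, annotated
-- with the variables that denote the instruction concerned. For a quantifier, a subset
-- construction follows all choices of the new variable at once. The instruction chosen is
-- identified by its slot in the window as long as it can still emit events, so that finitely
-- many states suffice. That each event is emitted exactly once is a property of the same kind.
module Submission where

open import Defs
open import Data.Bool using (Bool; true; false; _∧_; _∨_; if_then_else_)
open import Data.Bool.Properties using () renaming (_≟_ to _≟ᵇ_)
open import Data.Empty using (⊥; ⊥-elim)
open import Data.Fin using (Fin; toℕ; fromℕ<; zero; suc; inject₁; combine; remQuot; funToFin; finToFun) renaming (_≟_ to _≟ᶠ_)
open import Data.Fin.Properties using (toℕ-inject₁; toℕ-fromℕ<; any?; all?; 2↔Bool; remQuot-combine; finToFun-funToFin)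
open import Data.List using (List; []; _∷_; _++_; length; fromMaybe; allFin)
open import Data.List.Membership.Propositional using (_∈_)
open import Data.List.Membership.Propositional.Properties using (∈-++⁺ʳ; ∈-allFin)
open import Data.List.Properties using (++-identityʳ; ++-assoc)
open import Data.List.Relation.Unary.All as All using (All; []; _∷_)
import Data.List.Relation.Unary.All.Properties as Allₚ
open import Data.List.Relation.Unary.AllPairs using ([]; _∷_)
open import Data.List.Relation.Unary.Any using (here; there)
open import Data.List.Relation.Unary.Unique.Propositional using (Unique)
open import Data.Maybe using (Maybe; just; nothing; maybe)
import Data.Maybe.Properties as Maybeₚ
open import Data.Maybe.Properties using (just-injective)
open import Data.Nat using (ℕ; zero; suc; _+_; _*_; _^_; _∸_; _≤_; _<_; z≤n; s≤s; z<s; s<s) renaming (pred to predℕ)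
open import Data.Nat.DivMod using (_mod_; m<n⇒m%n≡m)
import Data.Nat.Properties as ℕₚ
open import Data.Product using (Σ; ∃; ∃₂; _×_; _,_; proj₁; proj₂)
import Data.Product.Properties as ×ₚ
open import Data.Sum using (_⊎_; inj₁; inj₂)
open import Data.Unit using (⊤; tt)
open import Data.Vec using (Vec; []; _∷_; tabulate; zipWith; replicate; _[_]≔_) renaming (lookup to vlookup; map to vmap)
open import Data.Vec.Properties using (lookup∘tabulate; tabulate∘lookup; tabulate-cong; map-cong; lookup-map; lookup-zipWith; lookup-replicate; lookup∘update; lookup∘update′)
import Data.Vec.Relation.Unary.All as VAll
import Data.Vec.Relation.Unary.All.Properties as VAllₚ
open import Function using (_∘_; id; case_of_; Inverse)
open import Level using (lower)
open import Relation.Binary.Construct.Closure.Transitive using ([_]; _∷_)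
open import Relation.Binary.Definitions using (DecidableEquality; tri<; tri≈; tri>)
open import Relation.Binary.PropositionalEquality
open import Relation.Nullary using (¬_; Dec; yes; no; does; proof; contradiction)
open import Relation.Nullary.Decidable using (dec-true; dec-false; map′; _×-dec_; _⊎-dec_; _→-dec_; ⊥-dec)
open import Relation.Nullary.Reflects using (Reflects; det; ofʸ; ofⁿ; _×-reflects_; _⊎-reflects_; _→-reflects_)

-- A trace does not show when instructions are read or dropped, so the central objects are histories
-- of actions, and one trace may have many of them. For a fixed program the truth of an axiom
-- depends on the emitted events alone: soundness takes the history that a run provides,
-- completeness is free to choose one. The obstacle is that labels are unbounded, so no automaton
-- can store which instruction a variable denotes. Order replaces labels. A core reads its stream in
-- order, so within a core `po` is precedence of reads just as `hb` is precedence of events, and one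
-- two-bit automaton serves both. An instruction that has left its window keeps its automaton state
-- in the subset construction, because events of the other variables can still change that state.
-- Position order agrees with `hbRel (Lin σ)` only on traces without repetitions. Hence recognisers
-- carry a hypothesis `H` on the history, and emission exactly once is checked alongside the axioms,
-- whose recognisers may then assume it.

map-reflects : {A B : Set} {b : Bool} → (A → B) → (B → A) → Reflects A b → Reflects B b
map-reflects f g (ofʸ a)  = ofʸ (f a)
map-reflects f g (ofⁿ ¬a) = ofⁿ (¬a ∘ g)

reflects-true : {A : Set} {b : Bool} → Reflects A b → b ≡ true → A
reflects-true (ofʸ a) _ = a

true-reflects : {A : Set} {b : Bool} → Reflects A b → A → b ≡ true
true-reflects (ofʸ _)  _ = refl
true-reflects (ofⁿ ¬a) a = contradiction a ¬a

≡true-reflects : ∀ b → Reflects (b ≡ true) b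
≡true-reflects true  = ofʸ refl
≡true-reflects false = ofⁿ λ ()

-- Finite types and their decidable subsets

-- A retraction is enough for equality tests and exhaustive search. Since an element may have
-- several codes, later statements about model states go through `decode`.
record Finite (A : Set) : Set where
  field
    size        : ℕ
    code        : A → Fin size
    decode      : Fin size → A
    decode-code : ∀ a → decode (code a) ≡ a

  _≟_ : DecidableEquality A
  a ≟ b = map′ (λ e → trans (sym (decode-code a)) (trans (cong decode e) (decode-code b)))
               (cong code) (code a ≟ᶠ code b)

  exists? : {P : A → Set} → (∀ a → Dec (P a)) → Dec (∃ P)
  exists? {P} P? = map′ (λ (x , p) → decode x , p)
    (λ (a , p) → code a , subst P (sym (decode-code a)) p) (any? (P? ∘ decode))

  forall? : {P : A → Set} → (∀ a → Dec (P a)) → Dec (∀ a → P a)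
  forall? {P} P? = map′ (λ f a → subst P (decode-code a) (f (code a)))
    (λ f → f ∘ decode) (all? (P? ∘ decode))

  -- Bit vectors rather than predicates, so that the subsets form a `Finite` type again and can be
  -- automaton states.
  Subset : Set
  Subset = Vec Bool size

  infix 4 _∈ˢ_
  _∈ˢ_ : A → Subset → Set
  a ∈ˢ S = vlookup S (code a) ≡ true

  _∈ˢ?_ : ∀ a S → Dec (a ∈ˢ S)
  a ∈ˢ? S = vlookup S (code a) ≟ᵇ true

  ⟦_⟧ : {P : A → Set} → (∀ a → Dec (P a)) → Subset
  ⟦ P? ⟧ = tabulate (does ∘ P? ∘ decode)

  module _ {P : A → Set} (P? : ∀ a → Dec (P a)) where

    private
      lookup-⟦⟧ : ∀ a → vlookup ⟦ P? ⟧ (code a) ≡ does (P? a)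
      lookup-⟦⟧ a = trans (lookup∘tabulate (does ∘ P? ∘ decode) (code a))
                          (cong (does ∘ P?) (decode-code a))

    ∈⟦⟧⁺ : ∀ {a} → P a → a ∈ˢ ⟦ P? ⟧
    ∈⟦⟧⁺ {a} p = trans (lookup-⟦⟧ a) (dec-true (P? a) p)

    ∈⟦⟧⁻ : ∀ {a} → a ∈ˢ ⟦ P? ⟧ → P a
    ∈⟦⟧⁻ {a} e = reflects-true (proof (P? a)) (trans (sym (lookup-⟦⟧ a)) e)

open Finite using (size; code; decode; decode-code; Subset)

finite-Fin : ∀ {m} → Finite (Fin m)
finite-Fin = record { code = id ; decode = id ; decode-code = λ _ → refl }

finite-Bool : Finite Bool
finite-Bool = record { code = from ; decode = to ; decode-code = strictlyInverseˡ }
  where open Inverse 2↔Bool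

finite-⊤ : Finite ⊤
finite-⊤ = record { size = 1 ; code = λ _ → zero ; decode = _ ; decode-code = λ _ → refl }

finite-Maybe : {A : Set} → Finite A → Finite (Maybe A)
finite-Maybe {A} F = record { size = suc (size F) ; code = c ; decode = d ; decode-code = dc }
  where
  c : Maybe A → Fin (suc (size F))
  c nothing  = zero
  c (just a) = suc (code F a)
  d : Fin (suc (size F)) → Maybe A
  d zero    = nothing
  d (suc x) = just (decode F x)
  dc : ∀ m → d (c m) ≡ m
  dc nothing  = refl
  dc (just a) = cong just (decode-code F a)

finite-× : {A B : Set} → Finite A → Finite B → Finite (A × B)
finite-× F G = record
  { size = size F * size G
  ; code = λ (a , b) → combine (code F a) (code G b)
  ; decode = λ x → let i , j = remQuot (size G) x in decode F i , decode G j
  ; decode-code = λ (a , b) →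
      trans (cong (λ (i , j) → decode F i , decode G j) (remQuot-combine (code F a) (code G b)))
            (cong₂ _,_ (decode-code F a) (decode-code G b))
  }

finite-Vec : {A : Set} (m : ℕ) → Finite A → Finite (Vec A m)
finite-Vec m F = record
  { size = size F ^ m
  ; code = λ v → funToFin (code F ∘ vlookup v)
  ; decode = λ x → tabulate (decode F ∘ finToFun x)
  ; decode-code = λ v → trans
      (tabulate-cong λ i → trans (cong (decode F) (finToFun-funToFin (code F ∘ vlookup v) i))
                                 (decode-code F (vlookup v i)))
      (tabulate∘lookup v)
  }

finite-Subset : {A : Set} (F : Finite A) → Finite (Subset F)
finite-Subset F = finite-Vec (size F) finite-Bool

sequence : {A : Set} {m : ℕ} → Vec (Maybe A) m → Maybe (Vec A m)
sequence []             = just []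
sequence (nothing ∷ _)  = nothing
sequence (just a ∷ v)   = Data.Maybe.map (a ∷_) (sequence v)

sequence-just : {A : Set} {m : ℕ} (u : Vec (Maybe A) m) (v : Vec A m) →
  (∀ x → vlookup u x ≡ just (vlookup v x)) → sequence u ≡ just v
sequence-just []      []      _ = refl
sequence-just (_ ∷ u) (a ∷ v) h with refl ← h zero =
  cong (Data.Maybe.map (a ∷_)) (sequence-just u v (h ∘ suc))

-- Occurrence and precedence in lists

module _ {A : Set} where

  -- The diagonal case `Precedes xs a a` means that `a` occurs twice; this is how freedom from
  -- repetitions is expressed as an order property.
  Precedes : List A → A → A → Set
  Precedes xs a b = ∃₂ λ k k' → k < k' × At xs k a × At xs k' b

  Occurs : List A → A → Set
  Occurs xs a = ∃ λ k → At xs k a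

  At-++ˡ : ∀ xs {ys k} {a : A} → At xs k a → At (xs ++ ys) k a
  At-++ˡ (x ∷ xs) {k = zero}  p = p
  At-++ˡ (x ∷ xs) {k = suc k} p = At-++ˡ xs p

  At-<length : ∀ xs {k} {a : A} → At xs k a → k < length xs
  At-<length (x ∷ xs) {zero}  _ = z<s
  At-<length (x ∷ xs) {suc k} p = s<s (At-<length xs p)

  At-last : ∀ xs {a : A} {m} → m ≡ just a → At (xs ++ fromMaybe m) (length xs) a
  At-last []       refl = refl
  At-last (x ∷ xs) e    = At-last xs e

  At-++⁻ : ∀ xs {m k} {a : A} → At (xs ++ fromMaybe m) k a →
    At xs k a ⊎ (k ≡ length xs × m ≡ just a)
  At-++⁻ [] {just x} {zero} p = inj₂ (refl , p)
  At-++⁻ (x ∷ xs) {k = zero}  p = inj₁ p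
  At-++⁻ (x ∷ xs) {k = suc k} p with At-++⁻ xs {k = k} p
  ... | inj₁ q       = inj₁ q
  ... | inj₂ (e , q) = inj₂ (cong suc e , q)

  occurs-++⁺ : ∀ xs {m} {a : A} → Occurs xs a ⊎ m ≡ just a → Occurs (xs ++ fromMaybe m) a
  occurs-++⁺ xs (inj₁ (k , p)) = k , At-++ˡ xs p
  occurs-++⁺ xs (inj₂ e)       = length xs , At-last xs e

  occurs-++⁻ : ∀ xs {m} {a : A} → Occurs (xs ++ fromMaybe m) a → Occurs xs a ⊎ m ≡ just a
  occurs-++⁻ xs (k , p) with At-++⁻ xs {k = k} p
  ... | inj₁ q       = inj₁ (k , q)
  ... | inj₂ (_ , e) = inj₂ e

  precedes-++⁺ : ∀ xs {m} {a b : A} → Precedes xs a b ⊎ (Occurs xs a × m ≡ just b) →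
    Precedes (xs ++ fromMaybe m) a b
  precedes-++⁺ xs (inj₁ (k , k' , lt , p , q)) = k , k' , lt , At-++ˡ xs p , At-++ˡ xs q
  precedes-++⁺ xs (inj₂ ((k , p) , e)) =
    k , length xs , At-<length xs p , At-++ˡ xs p , At-last xs e

  precedes-++⁻ : ∀ xs {m} {a b : A} → Precedes (xs ++ fromMaybe m) a b →
    Precedes xs a b ⊎ (Occurs xs a × m ≡ just b)
  precedes-++⁻ xs (k , k' , lt , p , q) with At-++⁻ xs {k = k} p | At-++⁻ xs {k = k'} q
  ... | inj₁ p'         | inj₁ q'         = inj₁ (k , k' , lt , p' , q')
  ... | inj₁ p'         | inj₂ (_ , e)    = inj₂ ((k , p') , e)
  ... | inj₂ (refl , _) | inj₁ q'         = contradiction (At-<length xs q') (ℕₚ.<⇒≯ lt)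
  ... | inj₂ (refl , _) | inj₂ (refl , _) = contradiction lt (ℕₚ.<-irrefl refl)

  ∈⇒occurs : ∀ {xs} {a : A} → a ∈ xs → Occurs xs a
  ∈⇒occurs (here refl) = 0 , refl
  ∈⇒occurs (there p)   = let k , q = ∈⇒occurs p in suc k , q

  At⇒∈ : ∀ xs {k} {a : A} → At xs k a → a ∈ xs
  At⇒∈ (x ∷ xs) {zero}  refl = here refl
  At⇒∈ (x ∷ xs) {suc k} p    = there (At⇒∈ xs p)

  unique⇒¬precedes : ∀ {xs} → Unique xs → ∀ {a : A} → ¬ Precedes xs a a
  unique⇒¬precedes {x ∷ xs} (_ ∷ u) (suc k , suc k' , s≤s lt , p , q) =
    unique⇒¬precedes u (k , k' , lt , p , q)
  unique⇒¬precedes {x ∷ xs} (x∉ ∷ _) (zero , suc k' , lt , refl , q) =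
    All.lookup x∉ (At⇒∈ xs q) refl

  ¬precedes⇒unique : ∀ xs → (∀ a → ¬ Precedes xs a a) → Unique xs
  ¬precedes⇒unique [] _ = []
  ¬precedes⇒unique (x ∷ xs) h =
    All.tabulate (λ { y∈ refl → let k , p = ∈⇒occurs y∈ in h _ (0 , suc k , z<s , refl , p) })
    ∷ ¬precedes⇒unique xs (λ a (k , k' , lt , p , q) → h a (suc k , suc k' , s<s lt , p , q))

  At-injective : ∀ {xs} → Unique xs → ∀ {k k'} {a : A} → At xs k a → At xs k' a → k ≡ k'
  At-injective u {k} {k'} p q with ℕₚ.<-cmp k k'
  ... | tri< lt _ _ = contradiction (k , k' , lt , p , q) (unique⇒¬precedes u)
  ... | tri≈ _ e _  = e
  ... | tri> _ _ gt = contradiction (k' , k , gt , q , p) (unique⇒¬precedes u)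

  !?-lookup : ∀ (xs : List A) {j} (v : j < length xs) → xs !? j ≡ just (Data.List.lookup xs (fromℕ< v))
  !?-lookup (x ∷ xs) {zero}  _       = refl
  !?-lookup (x ∷ xs) {suc j} (s≤s v) = !?-lookup xs v

module Synthesis (n o s r : ℕ) where
  open Semantics n o s

  t : ℕ
  t = suc r

  -- Happens-before in linear graphs

  Lin-∷ : ∀ {x σ e₁ e₂} → hbRel (Lin σ) e₁ e₂ → hbRel (Lin (x ∷ σ)) e₁ e₂
  Lin-∷ {x} [ xs , ys , e ]        = [ x ∷ xs , ys , cong (x ∷_) e ]
  Lin-∷ {x} ((xs , ys , e) ∷ rest) = (x ∷ xs , ys , cong (x ∷_) e) ∷ Lin-∷ rest

  precedes⇒hb : ∀ σ {e₁ e₂} → Precedes σ e₁ e₂ → hbRel (Lin σ) e₁ e₂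
  precedes⇒hb (x ∷ σ) (suc k , suc k' , s≤s lt , p , q) = Lin-∷ (precedes⇒hb σ (k , k' , lt , p , q))
  precedes⇒hb (x ∷ y ∷ σ) (zero , suc zero , _ , refl , refl) = [ [] , σ , refl ]
  precedes⇒hb (x ∷ y ∷ σ) (zero , suc (suc k') , _ , refl , q) =
    ([] , σ , refl) ∷ Lin-∷ (precedes⇒hb (y ∷ σ) (zero , suc k' , z<s , refl , q))

  Lin⇒consecutive : ∀ {σ e₁ e₂} → Lin σ e₁ e₂ → ∃ λ k → At σ k e₁ × At σ (suc k) e₂
  Lin⇒consecutive ([] , ys , refl)     = 0 , refl , refl
  Lin⇒consecutive (x ∷ xs , ys , refl) =
    let k , p , q = Lin⇒consecutive (xs , ys , refl) in suc k , p , q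

  -- Two links of a chain meet in an event found at one position by each link. Only uniqueness makes
  -- these positions equal.
  hb⇒precedes : ∀ {σ} → Unique σ → ∀ {e₁ e₂} → hbRel (Lin σ) e₁ e₂ → Precedes σ e₁ e₂
  hb⇒precedes u [ l ] = let k , p , q = Lin⇒consecutive l in k , suc k , ℕₚ.≤-refl , p , q
  hb⇒precedes u (l ∷ ls) with Lin⇒consecutive l | hb⇒precedes u ls
  ... | k , p , q | k₁ , k₂ , lt , p' , q' =
    k , k₂ , ℕₚ.<-trans (subst (k <_) (At-injective u q p') ℕₚ.≤-refl) lt , p , q'

  -- Histories and windows

  module _ {A : Set} (f : Core → A) (c : Core) (g : A → A) where

    upd-≡ : upd f c g c ≡ g (f c)
    upd-≡ with c ≟ᶠ c
    ... | yes _ = refl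
    ... | no ¬p = contradiction refl ¬p

    upd-≢ : ∀ {c'} → c' ≢ c → upd f c g c' ≡ f c'
    upd-≢ {c'} c'≢c with c' ≟ᶠ c
    ... | yes p = contradiction p c'≢c
    ... | no _  = refl

  -- The actions of a run, the most recent one first.
  data Item : Set where
    read : Core → Item
    emit : Core → ℕ → Stage → Item
    drop : Core → Item

  History : Set
  History = List Item

  pos : History → Core → ℕ
  pos []               = λ _ → 0
  pos (read c ∷ w)     = upd (pos w) c suc
  pos (emit _ _ _ ∷ w) = pos w
  pos (drop _ ∷ w)     = pos w

  -- Only the oldest retained instruction is ever dropped, so the window of a core is the
  -- interval of labels from low to pos.
  low : History → Core → ℕ
  low []               = λ _ → 0
  low (read _ ∷ w)     = low w
  low (emit _ _ _ ∷ w) = low w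
  low (drop c ∷ w)     = upd (low w) c suc

  data WF (P : Program) : History → Set where
    []   : WF P []
    read : ∀ {c w} → pos w c < length (P c) → pos w c < low w c + t → WF P w → WF P (read c ∷ w)
    emit : ∀ {c k st w} → low w c + k < pos w c → WF P w → WF P (emit c k st ∷ w)
    drop : ∀ {c w} → low w c < pos w c → WF P w → WF P (drop c ∷ w)

  wf-tail : ∀ {P a w} → WF P (a ∷ w) → WF P w
  wf-tail (read _ _ wf) = wf
  wf-tail (emit _ wf)   = wf
  wf-tail (drop _ wf)   = wf

  low≤pos : ∀ {P w} → WF P w → ∀ c → low w c ≤ pos w c
  low≤pos [] c = z≤n
  low≤pos (read {c'} {w} _ _ wf) c with c ≟ᶠ c'
  ... | yes _ = ℕₚ.m≤n⇒m≤1+n (low≤pos wf c)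
  ... | no _  = low≤pos wf c
  low≤pos (emit _ wf) c = low≤pos wf c
  low≤pos (drop {c'} {w} lt wf) c with c ≟ᶠ c'
  ... | yes refl = lt
  ... | no _     = low≤pos wf c

  pos≤length : ∀ {P w} → WF P w → ∀ c → pos w c ≤ length (P c)
  pos≤length [] c = z≤n
  pos≤length (read {c'} {w} lt _ wf) c with c ≟ᶠ c'
  ... | yes refl = lt
  ... | no _  = pos≤length wf c
  pos≤length (emit _ wf) c = pos≤length wf c
  pos≤length (drop _ wf) c = pos≤length wf c

  pos≤low+t : ∀ {P w} → WF P w → ∀ c → pos w c ≤ low w c + t
  pos≤low+t [] c = z≤n
  pos≤low+t (read {c'} {w} _ lt wf) c with c ≟ᶠ c'
  ... | yes refl = lt
  ... | no _  = pos≤low+t wf c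
  pos≤low+t (emit _ wf) c = pos≤low+t wf c
  pos≤low+t (drop {c'} {w} _ wf) c with c ≟ᶠ c'
  ... | yes refl = ℕₚ.m≤n⇒m≤1+n (pos≤low+t wf c)
  ... | no _  = pos≤low+t wf c

  IsRead : History → RInstr → Set
  IsRead w (c , j) = j < pos w c

  isRead-read⁻ : ∀ w c {i} → IsRead (read c ∷ w) i → IsRead w i ⊎ i ≡ (c , pos w c)
  isRead-read⁻ w c {c' , j} r with c' ≟ᶠ c
  ... | no _ = inj₁ r
  ... | yes refl with ℕₚ.m≤n⇒m<n∨m≡n (ℕₚ.≤-pred r)
  ...   | inj₁ lt   = inj₁ lt
  ...   | inj₂ refl = inj₂ refl

  isRead-read⁺ : ∀ w c {i} → IsRead w i ⊎ i ≡ (c , pos w c) → IsRead (read c ∷ w) i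
  isRead-read⁺ w c {c' , j} r with c' ≟ᶠ c
  isRead-read⁺ w c (inj₁ lt)   | yes refl = ℕₚ.m≤n⇒m≤1+n lt
  isRead-read⁺ w c (inj₂ refl) | yes refl = ℕₚ.≤-refl
  isRead-read⁺ w c (inj₁ lt)   | no _     = lt
  isRead-read⁺ w c (inj₂ refl) | no ¬p    = contradiction refl ¬p

  Full : Program → History → Set
  Full P w = WF P w × (∀ c → pos w c ≡ length (P c))

  full⇒isRead : ∀ {P w} → Full P w → (i : Instr P) → IsRead w (proj₁ i)
  full⇒isRead (_ , full) ((c , j) , v) = subst (j <_) (sym (full c)) v

  -- Letters, automata and recognisers

  -- Labels are absent: a symbol has to be computable from the heads, the window lengths and the
  -- action. The number in `read` is the slot that the new instruction will occupy, that is, the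
  -- window length before the move.
  data Symbol : Set where
    read : Core → Maybe Op → ℕ → Symbol
    emit : Core → ℕ → Stage → Symbol
    drop : Core → Symbol

  -- The marks tell which of the k variables denote the instruction read or emitted.
  Letter : ℕ → Set
  Letter k = Symbol × Vec Bool k

  symbol : Program → History → Item → Symbol
  symbol P w (read c)      = read c (P c !? pos w c) (pos w c ∸ low w c)
  symbol P w (emit c k st) = emit c k st
  symbol P w (drop c)      = drop c

  target : History → Item → Maybe RInstr
  target w (read c)      = just (c , pos w c)
  target w (emit c k _)  = just (c , low w c + k)
  target w (drop c)      = nothing

  _≟ᵢ_ : DecidableEquality RInstr
  _≟ᵢ_ = ×ₚ.≡-dec _≟ᶠ_ ℕₚ._≟_

  _≟ₘ_ : DecidableEquality (Maybe RInstr)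
  _≟ₘ_ = Maybeₚ.≡-dec _≟ᵢ_

  marked : ∀ {P} → Maybe RInstr → Instr P → Bool
  marked m i = does (just (proj₁ i) ≟ₘ m)

  letter : (P : Program) {k : ℕ} → Vec (Instr P) k → History → Item → Letter k
  letter P ρ w a = symbol P w a , vmap (marked {P} (target w a)) ρ

  marks-reflect : ∀ P {k} (ρ : Vec (Instr P) k) m x →
    Reflects (just (proj₁ (vlookup ρ x)) ≡ m) (vlookup (vmap (marked {P} m) ρ) x)
  marks-reflect P ρ m x rewrite lookup-map x (marked {P} m) ρ = proof (just (proj₁ (vlookup ρ x)) ≟ₘ m)

  record Automaton (k : ℕ) : Set₁ where
    field
      State  : Set
      finite : Finite State
      start  : State
      δ      : State → Letter k → State
      acc    : State → Bool

    run : (P : Program) → Vec (Instr P) k → History → State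
    run P ρ []      = start
    run P ρ (a ∷ w) = δ (run P ρ w) (letter P ρ w a)

  Property : ℕ → Set₁
  Property k = (P : Program) → History → Vec (Instr P) k → Set

  -- Correctness is claimed for full histories, since an automaton learns of an instruction only
  -- when it is read, whereas quantifiers range over all of `Instr P`.
  record Recogniser (H : Program → History → Set) (k : ℕ) (Φ : Property k) : Set₁ where
    field
      automaton : Automaton k
    open Automaton automaton public
    field
      correct : ∀ {P w} → Full P w → H P w → ∀ ρ → Reflects (Φ P w ρ) (acc (run P ρ w))

  open Recogniser

  -- Recognising order: reads and events

  module _ {X : Set} (new : History → Item → Maybe X) where

    -- Histories grow at the front and logs at the end, so positions in a log are points in time and
    -- do not change later.
    log : History → List X
    log []      = []
    log (a ∷ w) = log w ++ fromMaybe (new w a)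

    module _ {k : ℕ} (x₁ x₂ : ∀ {P} → Vec (Instr P) k → X)
      (test₁ test₂ : Letter k → Bool)
      (test₁-reflects : ∀ P ρ w a → Reflects (new w a ≡ just (x₁ {P} ρ)) (test₁ (letter P ρ w a)))
      (test₂-reflects : ∀ P ρ w a → Reflects (new w a ≡ just (x₂ {P} ρ)) (test₂ (letter P ρ w a)))
      where

      -- The state records whether x₁ has occurred, and whether x₂ has occurred after x₁.
      orderAutomaton : (Bool × Bool → Bool) → Automaton k
      orderAutomaton acc = record
        { finite = finite-× finite-Bool finite-Bool
        ; start  = false , false
        ; δ      = λ (b , b') l → b ∨ test₁ l , b' ∨ (b ∧ test₂ l)
        ; acc    = acc
        }

      -- The second bit combines `test₂` with the first bit as it was before the letter, because the
      -- new last entry is preceded by the older entries only, not by itself.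
      order-correct : ∀ acc {P} w ρ → let b , b' = Automaton.run (orderAutomaton acc) P ρ w in
        Reflects (Occurs (log w) (x₁ {P} ρ)) b × Reflects (Precedes (log w) (x₁ {P} ρ) (x₂ {P} ρ)) b'
      order-correct acc [] ρ = ofⁿ (λ ()) , ofⁿ (λ ())
      order-correct acc {P} (a ∷ w) ρ =
        let r , r' = order-correct acc w ρ in
        map-reflects (occurs-++⁺ (log w)) (occurs-++⁻ (log w))
          (r ⊎-reflects test₁-reflects P ρ w a) ,
        map-reflects (precedes-++⁺ (log w)) (precedes-++⁻ (log w))
          (r' ⊎-reflects (r ×-reflects test₂-reflects P ρ w a))

      occurs-recogniser : ∀ {H} → Recogniser H k λ P w ρ → Occurs (log w) (x₁ {P} ρ)
      occurs-recogniser .automaton = orderAutomaton proj₁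
      occurs-recogniser .correct {w = w} _ _ ρ = proj₁ (order-correct proj₁ w ρ)

      precedes-recogniser : ∀ {H} → Recogniser H k λ P w ρ → Precedes (log w) (x₁ {P} ρ) (x₂ {P} ρ)
      precedes-recogniser .automaton = orderAutomaton proj₂
      precedes-recogniser .correct {w = w} _ _ ρ = proj₂ (order-correct proj₂ w ρ)

  newRead : History → Item → Maybe RInstr
  newRead w (read c)     = just (c , pos w c)
  newRead w (emit _ _ _) = nothing
  newRead w (drop _)     = nothing

  newEvent : History → Item → Maybe REvent
  newEvent w (read _)      = nothing
  newEvent w (emit c k st) = just ((c , low w c + k) , st)
  newEvent w (drop _)      = nothing

  reads : History → List RInstr
  reads = log newRead

  events : History → List REvent
  events = log newEvent

  testRead : ∀ {k} → Fin k → Letter k → Bool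
  testRead x (read _ _ _ , ms) = vlookup ms x
  testRead x (emit _ _ _ , _)  = false
  testRead x (drop _ , _)      = false

  testRead-reflects : ∀ {k} (x : Fin k) P ρ w a →
    Reflects (newRead w a ≡ just (proj₁ (vlookup ρ x))) (testRead x (letter P ρ w a))
  testRead-reflects x P ρ w (read c)     = map-reflects sym sym (marks-reflect P ρ _ x)
  testRead-reflects x P ρ w (emit _ _ _) = ofⁿ λ ()
  testRead-reflects x P ρ w (drop _)     = ofⁿ λ ()

  testEvent : ∀ {k} → Fin k → Stage → Letter k → Bool
  testEvent x st (read _ _ _ , _)    = false
  testEvent x st (emit _ _ st' , ms) = vlookup ms x ∧ does (st' ≟ᶠ st)
  testEvent x st (drop _ , _)        = false

  testEvent-reflects : ∀ {k} (x : Fin k) st P ρ w a →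
    Reflects (newEvent w a ≡ just (proj₁ (vlookup ρ x) , st)) (testEvent x st (letter P ρ w a))
  testEvent-reflects x st P ρ w (read c)       = ofⁿ λ ()
  testEvent-reflects x st P ρ w (emit c k st') = map-reflects
    (λ (e , e') → cong just (cong₂ _,_ (sym (just-injective e)) e'))
    (λ e → cong just (sym (cong proj₁ (just-injective e))) , cong proj₂ (just-injective e))
    (marks-reflect P ρ _ x ×-reflects proof (st' ≟ᶠ st))
  testEvent-reflects x st P ρ w (drop _)       = ofⁿ λ ()

  occurs-reads⇒isRead : ∀ w {i} → Occurs (reads w) i → IsRead w i
  occurs-reads⇒isRead (read c ∷ w) r with occurs-++⁻ (reads w) r
  ... | inj₁ r'   = isRead-read⁺ w c (inj₁ (occurs-reads⇒isRead w r'))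
  ... | inj₂ refl = isRead-read⁺ w c (inj₂ refl)
  occurs-reads⇒isRead (emit _ _ _ ∷ w) r with occurs-++⁻ (reads w) r
  ... | inj₁ r'   = occurs-reads⇒isRead w r'
  occurs-reads⇒isRead (drop _ ∷ w) r with occurs-++⁻ (reads w) r
  ... | inj₁ r'   = occurs-reads⇒isRead w r'

  isRead⇒occurs-reads : ∀ w {i} → IsRead w i → Occurs (reads w) i
  isRead⇒occurs-reads (read c ∷ w) r with isRead-read⁻ w c r
  ... | inj₁ r'   = occurs-++⁺ (reads w) (inj₁ (isRead⇒occurs-reads w r'))
  ... | inj₂ refl = occurs-++⁺ (reads w) (inj₂ refl)
  isRead⇒occurs-reads (emit _ _ _ ∷ w) r = occurs-++⁺ (reads w) (inj₁ (isRead⇒occurs-reads w r))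
  isRead⇒occurs-reads (drop _ ∷ w)     r = occurs-++⁺ (reads w) (inj₁ (isRead⇒occurs-reads w r))

  -- The label being read is `pos w c`, and whatever the core has read before lies below it.
  precedes-reads⇒< : ∀ w {c j j'} → Precedes (reads w) (c , j) (c , j') → j < j'
  precedes-reads⇒< (read c ∷ w) r with precedes-++⁻ (reads w) r
  ... | inj₁ r'         = precedes-reads⇒< w r'
  ... | inj₂ (r' , refl) = occurs-reads⇒isRead w r'
  precedes-reads⇒< (emit _ _ _ ∷ w) r with precedes-++⁻ (reads w) r
  ... | inj₁ r'         = precedes-reads⇒< w r'
  precedes-reads⇒< (drop _ ∷ w) r with precedes-++⁻ (reads w) r
  ... | inj₁ r'         = precedes-reads⇒< w r'

  <⇒precedes-reads : ∀ w {c j j'} → j < j' → IsRead w (c , j') → Precedes (reads w) (c , j) (c , j')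
  <⇒precedes-reads (read c ∷ w) lt r with isRead-read⁻ w c r
  ... | inj₁ r'   = precedes-++⁺ (reads w) (inj₁ (<⇒precedes-reads w lt r'))
  ... | inj₂ refl = precedes-++⁺ (reads w) (inj₂ (isRead⇒occurs-reads w lt , refl))
  <⇒precedes-reads (emit _ _ _ ∷ w) lt r = precedes-++⁺ (reads w) (inj₁ (<⇒precedes-reads w lt r))
  <⇒precedes-reads (drop _ ∷ w) lt r = precedes-++⁺ (reads w) (inj₁ (<⇒precedes-reads w lt r))

  open Automaton using (State; start; δ)

  -- Boolean combinations of recognisers

  equivalent : ∀ {H k} {Φ Ψ : Property k} →
    (∀ {P w} → Full P w → H P w → ∀ ρ → (Φ P w ρ → Ψ P w ρ) × (Ψ P w ρ → Φ P w ρ)) →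
    Recogniser H k Φ → Recogniser H k Ψ
  equivalent h R .automaton = automaton R
  equivalent h R .correct full hw ρ =
    let f , g = h full hw ρ in map-reflects f g (correct R full hw ρ)

  constant : ∀ {H k b} {Φ : Property k} → (∀ P w ρ → Reflects (Φ P w ρ) b) → Recogniser H k Φ
  constant {b = b} r .automaton =
    record { finite = finite-⊤ ; start = tt ; δ = λ q _ → q ; acc = λ _ → b }
  constant r .correct {P} {w} _ _ = r P w

  module _ {k : ℕ} (M₁ M₂ : Automaton k) (_∙_ : Bool → Bool → Bool) where

    product : Automaton k
    product = record
      { finite = finite-× (Automaton.finite M₁) (Automaton.finite M₂)
      ; start  = start M₁ , start M₂
      ; δ      = λ (q₁ , q₂) l → δ M₁ q₁ l , δ M₂ q₂ l
      ; acc    = λ (q₁ , q₂) → Automaton.acc M₁ q₁ ∙ Automaton.acc M₂ q₂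
      }

    run-product : ∀ P ρ w → Automaton.run product P ρ w ≡ (Automaton.run M₁ P ρ w , Automaton.run M₂ P ρ w)
    run-product P ρ []      = refl
    run-product P ρ (a ∷ w) = cong (λ q → δ product q _) (run-product P ρ w)

  combination : {_∙_ : Bool → Bool → Bool} {_⊛_ : Set → Set → Set} →
    (∀ {A B a b} → Reflects A a → Reflects B b → Reflects (A ⊛ B) (a ∙ b)) →
    ∀ {H k} {Φ Ψ : Property k} → Recogniser H k Φ → Recogniser H k Ψ →
    Recogniser H k (λ P w ρ → Φ P w ρ ⊛ Ψ P w ρ)
  combination {_∙_} _ R₁ R₂ .automaton = product (automaton R₁) (automaton R₂) _∙_
  combination {_∙_} r R₁ R₂ .correct {P} {w} full hw ρ
    rewrite run-product (automaton R₁) (automaton R₂) _∙_ P ρ w =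
    r (correct R₁ full hw ρ) (correct R₂ full hw ρ)

  complement : ∀ {H k} {Φ : Property k} → Recogniser H k Φ → Recogniser H k (λ P w ρ → ¬ Φ P w ρ)
  complement R = combination _→-reflects_ R (constant λ _ _ _ → ofⁿ id)

  _and_ : ∀ {H k} {Φ Ψ : Property k} → Recogniser H k Φ → Recogniser H k Ψ →
    Recogniser H k (λ P w ρ → Φ P w ρ × Ψ P w ρ)
  _and_ = combination _×-reflects_

  all : ∀ {H k} {X : Set} {Φ : X → Property k} {xs} → All (Recogniser H k ∘ Φ) xs →
    Recogniser H k (λ P w ρ → All (λ x → Φ x P w ρ) xs)
  all []       = constant λ _ _ _ → ofʸ []
  all (R ∷ Rs) = equivalent (λ _ _ _ → (λ (p , ps) → p ∷ ps) , λ { (p ∷ ps) → p , ps }) (R and all Rs)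

  -- R₂ may rely on what R₁ checks.
  _andThen_ : ∀ {H} {Φ Ψ : Property 0} → Recogniser H 0 Φ →
    Recogniser (λ P w → Full P w × Φ P w []) 0 Ψ → Recogniser H 0 (λ P w ρ → Φ P w ρ × Ψ P w ρ)
  (R₁ andThen R₂) .automaton = product (automaton R₁) (automaton R₂) _∧_
  (R₁ andThen R₂) .correct {P} {w} full hw []
    rewrite run-product (automaton R₁) (automaton R₂) _∧_ P [] w
    with acc R₁ (run R₁ P [] w) | correct R₁ full hw []
  ... | true  | ofʸ p  = ofʸ p ×-reflects correct R₂ full (full , p) []
  ... | false | ofⁿ ¬p = ofⁿ (¬p ∘ proj₁)

  -- Cores and operations of the variables

  module _ {k : ℕ} where

    attributes : (P : Program) → Vec (Instr P) k → Vec (Core × Op) k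
    attributes P = vmap λ i → core (proj₁ i) , opOf P i

    -- An operation is visible only while the head is on it, so it has to be stored at the moment of
    -- reading, when the mark tells whose it is.
    recordAttributes : Vec (Maybe (Core × Op)) k → Letter k → Vec (Maybe (Core × Op)) k
    recordAttributes v (read c op _ , ms) =
      zipWith (λ b old → if b then Data.Maybe.map (c ,_) op else old) ms v
    recordAttributes v (emit _ _ _ , _)   = v
    recordAttributes v (drop _ , _)       = v

    module _ (g : Vec (Core × Op) k → Bool) where

      attributesAutomaton : Automaton k
      attributesAutomaton = record
        { finite = finite-Vec k (finite-Maybe (finite-× finite-Fin finite-Fin))
        ; start  = replicate k nothing
        ; δ      = recordAttributes
        -- The default is never reached on a full history: there every variable has been recorded.
        ; acc    = maybe g false ∘ sequence
        }

      attributes-recorded : ∀ P ρ w → WF P w → ∀ x → IsRead w (proj₁ (vlookup ρ x)) →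
        vlookup (Automaton.run attributesAutomaton P ρ w) x ≡
          just (core (proj₁ (vlookup ρ x)) , opOf P (vlookup ρ x))
      attributes-recorded P ρ (read c ∷ w) (read _ _ wf) x r
        rewrite lookup-zipWith (λ b old → if b then Data.Maybe.map (c ,_) (P c !? pos w c) else old) x
                  (vmap (marked {P} (just (c , pos w c))) ρ) (Automaton.run attributesAutomaton P ρ w)
        with vlookup (vmap (marked {P} (just (c , pos w c))) ρ) x | marks-reflect P ρ (just (c , pos w c)) x
           | isRead-read⁻ w c r
      ... | false | ofⁿ _  | inj₁ r' = attributes-recorded P ρ w wf x r'
      ... | false | ofⁿ ¬e | inj₂ e  = contradiction (cong just e) ¬e
      ... | true  | ofʸ e  | _ with vlookup ρ x
      attributes-recorded P ρ (read c ∷ w) (read _ _ wf) x r | true | ofʸ refl | _ | (_ , v) =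
        cong (Data.Maybe.map (c ,_)) (!?-lookup (P c) v)
      attributes-recorded P ρ (emit _ _ _ ∷ w) (emit _ wf) x r = attributes-recorded P ρ w wf x r
      attributes-recorded P ρ (drop _ ∷ w)     (drop _ wf) x r = attributes-recorded P ρ w wf x r

      attributes-recogniser : ∀ {H} → Recogniser H k (λ P w ρ → g (attributes P ρ) ≡ true)
      attributes-recogniser .automaton = attributesAutomaton
      attributes-recogniser .correct {P} {w} full@(wf , _) _ ρ
        rewrite sequence-just (Automaton.run attributesAutomaton P ρ w) (attributes P ρ)
          (λ x → trans (attributes-recorded P ρ w wf x (full⇒isRead full (vlookup ρ x)))
                       (cong just (sym (lookup-map x (λ i → core (proj₁ i) , opOf P i) ρ)))) =
        ≡true-reflects (g (attributes P ρ))

  -- Universal quantification by a subset construction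

  -- A tracker locates an instruction already read: its slot in the window of its core,
  -- or nothing once it has been dropped.
  Tracker : Set
  Tracker = Maybe (Core × Fin t)

  Tracks : History → RInstr → Tracker → Set
  Tracks w (c , j) nothing         = j < low w c
  Tracks w (c , j) (just (c' , k)) = c' ≡ c × low w c + toℕ k ≡ j

  -- Slots count from the oldest retained instruction. A drop thus removes slot zero and renumbers
  -- all others of the core, while reads leave slots alone.
  shift : ∀ {m} → Core → Fin m → Maybe (Core × Fin m)
  shift c zero    = nothing
  shift c (suc k) = just (c , inject₁ k)

  advance : Symbol → Tracker → Tracker
  advance (drop c) (just (c' , k)) = if does (c ≟ᶠ c') then shift c' k else just (c' , k)
  advance _        τ               = τ

  hit : Symbol → Tracker → Bool
  hit (emit c k _) (just (c' , k')) = does (c' ≟ᶠ c) ∧ does (toℕ k' ℕₚ.≟ k)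
  hit _            _                = false

  isRead-∷ : ∀ a {w i} → IsRead w i → IsRead (a ∷ w) i
  isRead-∷ (read c) {w} r = isRead-read⁺ w c (inj₁ r)
  isRead-∷ (emit _ _ _) r = r
  isRead-∷ (drop _)     r = r

  target⇒isRead : ∀ {P w a i} → WF P (a ∷ w) → just i ≡ target w a → IsRead (a ∷ w) i
  target⇒isRead {w = w} {read c} _    refl = isRead-read⁺ w c (inj₂ refl)
  target⇒isRead {a = emit _ _ _} (emit lt _) refl = lt

  shift-tracks : ∀ {m} (c : Core) (k : Fin m) → ∀ {l j} → l + toℕ k ≡ j →
    (shift c k ≡ nothing × j < suc l) ⊎ (∃ λ k' → shift c k ≡ just (c , k') × suc l + toℕ k' ≡ j)
  shift-tracks c zero    {l} refl = inj₁ (refl , s≤s (ℕₚ.≤-reflexive (ℕₚ.+-identityʳ l)))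
  shift-tracks c (suc k) {l} refl =
    inj₂ (inject₁ k , refl , trans (cong (suc l +_) (toℕ-inject₁ k)) (sym (ℕₚ.+-suc l (toℕ k))))

  tracks-∷ : ∀ P a w i τ → Tracks w i τ → Tracks (a ∷ w) i (advance (symbol P w a) τ)
  tracks-∷ P (read _)     w i nothing  h = h
  tracks-∷ P (read _)     w i (just _) h = h
  tracks-∷ P (emit _ _ _) w i nothing  h = h
  tracks-∷ P (emit _ _ _) w i (just _) h = h
  tracks-∷ P (drop c) w (c' , j) nothing h with c' ≟ᶠ c
  ... | yes _ = ℕₚ.m≤n⇒m≤1+n h
  ... | no _  = h
  tracks-∷ P (drop c) w (c' , j) (just (.c' , k)) (refl , h) with c ≟ᶠ c'
  ... | no ¬p = refl , trans (cong (_+ toℕ k) (upd-≢ (low w) c suc (¬p ∘ sym))) h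
  ... | yes refl with shift-tracks c k h
  ...   | inj₁ (e , lt) rewrite e = subst (j <_) (sym (upd-≡ (low w) c suc)) lt
  ...   | inj₂ (k' , e , h') rewrite e = refl , trans (cong (_+ toℕ k') (upd-≡ (low w) c suc)) h'

  hit-reflects : ∀ P a w i τ → IsRead w i → Tracks w i τ →
    Reflects (just i ≡ target w a) (hit (symbol P w a) τ)
  hit-reflects P (read c)     w i τ        r h = ofⁿ λ { refl → ℕₚ.<-irrefl refl r }
  hit-reflects P (drop _)     w i τ        r h = ofⁿ λ ()
  hit-reflects P (emit c k _) w i nothing  r h = ofⁿ λ { refl → ℕₚ.<⇒≱ h (ℕₚ.m≤m+n _ k) }
  hit-reflects P (emit c k _) w (c' , _) (just (.c' , k')) r (refl , refl) = map-reflects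
    (λ { (refl , refl) → refl })
    (λ e → let e₁ = just-injective e in cong proj₁ e₁ ,
      ℕₚ.+-cancelˡ-≡ (low w c') (toℕ k') k
        (trans (cong proj₂ e₁) (cong (λ c → low w c + k) (sym (cong proj₁ e₁)))))
    (proof (c' ≟ᶠ c) ×-reflects proof (toℕ k' ℕₚ.≟ k))

  module _ {H k} {Φ : Property (suc k)} (R : Recogniser H (suc k) Φ) where

    private
      Q = State (automaton R)

      finiteTracked : Finite (Tracker × Q)
      finiteTracked = finite-× (finite-Maybe (finite-× finite-Fin finite-Fin)) (finite R)

      open Finite finiteTracked using (_∈ˢ_; _∈ˢ?_; ∈⟦⟧⁺; ∈⟦⟧⁻; exists?; forall?; ⟦_⟧)

      step : Q → Letter (suc k) → Q
      step = δ (automaton R)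

      -- The incoming letter has no mark for the new variable; `hit` reconstructs it from the
      -- tracker.
      survive : Letter k → Tracker × Q → Tracker × Q
      survive (a , ms) (τ , q) = advance a τ , step q (a , hit a τ ∷ ms)

      -- The variable starts to denote the instruction being read, unless another variable does.
      Born : Q → Letter k → Tracker × Q → Set
      Born u (read c op l , ms) (just (c' , slot) , q) =
        VAll.All (_≡ false) ms × c' ≡ c × toℕ slot ≡ l × q ≡ step u (read c op l , true ∷ ms)
      Born _ _ _ = ⊥

      born? : ∀ u l b → Dec (Born u l b)
      born? u (read c op l , ms) (just (c' , slot) , q) =
        VAll.all? (_≟ᵇ false) ms ×-dec c' ≟ᶠ c ×-dec toℕ slot ℕₚ.≟ l
          ×-dec Finite._≟_ (finite R) q (step u (read c op l , true ∷ ms))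
      born? u (read _ _ _ , _) (nothing , _) = no id
      born? u (emit _ _ _ , _) b             = no id
      born? u (drop _ , _)     b             = no id

      Next : Q × Subset finiteTracked → Letter k → Tracker × Q → Set
      Next (u , B) l b = (∃ λ a → a ∈ˢ B × survive l a ≡ b) ⊎ Born u l b

      next? : ∀ uB l b → Dec (Next uB l b)
      next? (u , B) l b =
        exists? (λ a → a ∈ˢ? B ×-dec Finite._≟_ finiteTracked (survive l a) b) ⊎-dec born? u l b

    -- A subset construction: the first component is the state of the automaton as long as the
    -- new variable denotes no instruction read so far, the second one collects the states for
    -- all instructions already read, together with what is needed to recognise them later.
    forAllAutomaton : Automaton k
    forAllAutomaton = record
      { finite = finite-× (finite R) (finite-Subset finiteTracked)
      ; start  = start (automaton R) , ⟦ (λ _ → ⊥-dec) ⟧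
      ; δ      = λ { (u , B) (a , ms) → step u (a , false ∷ ms) , ⟦ next? (u , B) (a , ms) ⟧ }
      ; acc    = λ (u , B) → does (forall? λ b → (b ∈ˢ? B) →-dec (acc R (proj₂ b) ≟ᵇ true))
      }

    private
      run∀ : ∀ P → Vec (Instr P) k → History → Q × Subset finiteTracked
      run∀ = Automaton.run forAllAutomaton

      -- No action concerns an instruction before it is read, since emissions stay inside the
      -- window. All unread choices therefore share one run, in which the new mark is always false.
      run-unread : ∀ P ρ w → WF P w → (i : Instr P) → ¬ IsRead w (proj₁ i) →
        proj₁ (run∀ P ρ w) ≡ run R P (i ∷ ρ) w
      run-unread P ρ []      _  i _  = refl
      run-unread P ρ (a ∷ w) wf i ¬r = cong₂ step
        (run-unread P ρ w (wf-tail wf) i (¬r ∘ isRead-∷ a))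
        (cong (λ b → symbol P w a , b ∷ _) (sym (dec-false (just (proj₁ i) ≟ₘ target w a) (¬r ∘ target⇒isRead wf))))

      survive-run : ∀ P ρ a w (i : Instr P) τ → IsRead w (proj₁ i) → Tracks w (proj₁ i) τ →
        survive (letter P ρ w a) (τ , run R P (i ∷ ρ) w) ≡ (advance (symbol P w a) τ , run R P (i ∷ ρ) (a ∷ w))
      survive-run P ρ a w i τ r h = cong (λ b → advance (symbol P w a) τ , step _ (symbol P w a , b ∷ _))
        (det (hit-reflects P a w (proj₁ i) τ r h) (proof (just (proj₁ i) ≟ₘ target w a)))

      Present : ∀ P → Vec (Instr P) k → History → Instr P → Set
      Present P ρ w i = ∃ λ τ → Tracks w (proj₁ i) τ × (τ , run R P (i ∷ ρ) w) ∈ˢ proj₂ (run∀ P ρ w)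

      present-survives : ∀ P ρ a w i → IsRead w (proj₁ i) → Present P ρ w i → Present P ρ (a ∷ w) i
      present-survives P ρ a w i r (τ , h , m) =
        advance (symbol P w a) τ , tracks-∷ P a w (proj₁ i) τ h ,
        ∈⟦⟧⁺ (next? (run∀ P ρ w) (letter P ρ w a)) (inj₁ (_ , m , survive-run P ρ a w i τ r h))

      present : ∀ P ρ w → WF P w → (i : Instr P) → IsRead w (proj₁ i) → Fresh {P} i ρ → Present P ρ w i
      present P ρ (emit c k st ∷ w) (emit _ wf) i r f =
        present-survives P ρ (emit c k st) w i r (present P ρ w wf i r f)
      present P ρ (drop c ∷ w) (drop _ wf) i r f =
        present-survives P ρ (drop c) w i r (present P ρ w wf i r f)
      present P ρ (read c ∷ w) (read lt lt' wf) i r f with isRead-read⁻ w c r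
      ... | inj₁ r' = present-survives P ρ (read c) w i r' (present P ρ w wf i r' f)
      present P ρ (read c ∷ w) (read lt lt' wf) i@(_ , v) r f | inj₂ refl =
        -- The newly read instruction takes the slot after the current window, which exists because
        -- `read` requires room.
        just (c , fromℕ< slot<t) ,
        (refl , trans (cong (low w c +_) (toℕ-fromℕ< slot<t)) (ℕₚ.m+[n∸m]≡n (low≤pos wf c))) ,
        ∈⟦⟧⁺ (next? (run∀ P ρ w) (letter P ρ w (read c))) (inj₂
          ( VAllₚ.map⁺ (VAll.map
              (λ {i'} ne → dec-false (just (proj₁ i') ≟ₘ just (c , pos w c)) (ne ∘ just-injective)) f)
          , refl , toℕ-fromℕ< slot<t
          , cong₂ step (sym (run-unread P ρ w wf i (ℕₚ.<-irrefl refl)))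
              (cong (λ b → symbol P w (read c) , b ∷ proj₂ (letter P ρ w (read c)))
                (dec-true (just (c , pos w c) ≟ₘ just (c , pos w c)) refl))))
        where
        slot<t : pos w c ∸ low w c < t
        slot<t = ℕₚ.+-cancelˡ-< (low w c) _ _ (subst (_< low w c + t) (sym (ℕₚ.m+[n∸m]≡n (low≤pos wf c))) lt')

      Origin : ∀ P → Vec (Instr P) k → History → Tracker × Q → Set
      Origin P ρ w (τ , q) = Σ (Instr P) λ i →
        IsRead w (proj₁ i) × Fresh {P} i ρ × Tracks w (proj₁ i) τ × q ≡ run R P (i ∷ ρ) w

      -- The converse of `present`: nothing spurious is collected. Freshness comes from the birth,
      -- at which all other marks had to be false.
      origin : ∀ P ρ w → WF P w → ∀ b → b ∈ˢ proj₂ (run∀ P ρ w) → Origin P ρ w b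
      origin P ρ [] _ b m = ⊥-elim (lower (∈⟦⟧⁻ (λ _ → ⊥-dec) {b} m))
      origin P ρ (a ∷ w) wf b m with ∈⟦⟧⁻ (next? (run∀ P ρ w) (letter P ρ w a)) {b} m
      ... | inj₁ ((τ , q) , m' , refl) with origin P ρ w (wf-tail wf) (τ , q) m'
      ...   | i , r , f , h , refl = i , isRead-∷ a r , f , tracks-∷ P a w (proj₁ i) τ h ,
                                     cong proj₂ (survive-run P ρ a w i τ r h)
      origin P ρ (read c ∷ w) (read lt _ wf) (just (.c , slot) , q) m | inj₂ (fs , refl , e , refl) =
        ((c , pos w c) , lt) , isRead-read⁺ w c (inj₂ refl) ,
        VAll.map (λ {i'} e ne → contradiction
            (trans (sym (dec-true (just (proj₁ i') ≟ₘ just (c , pos w c)) (cong just ne))) e) λ ())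
          (VAllₚ.map⁻ fs) ,
        (refl , trans (cong (low w c +_) e) (ℕₚ.m+[n∸m]≡n (low≤pos wf c))) ,
        cong₂ step (run-unread P ρ w wf _ (ℕₚ.<-irrefl refl))
              (cong (λ b → symbol P w (read c) , b ∷ proj₂ (letter P ρ w (read c)))
                (sym (dec-true (just (c , pos w c) ≟ₘ just (c , pos w c)) refl)))

    -- Acceptance looks only at the collected states, because on a full history no choice of the new
    -- variable is still unread.
    forAll : Recogniser H k (λ P w ρ → (i : Instr P) → Fresh {P} i ρ → Φ P w (i ∷ ρ))
    forAll .automaton = forAllAutomaton
    forAll .correct {P} {w} full@(wf , _) hw ρ = map-reflects
      (λ ok i f → let τ , _ , m = present P ρ w wf i (full⇒isRead full i) f in
        reflects-true (correct R full hw (i ∷ ρ)) (ok (τ , run R P (i ∷ ρ) w) m))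
      (λ { φ (τ , q) m → let i , _ , f , _ , e = origin P ρ w wf (τ , q) m in
        trans (cong (acc R) e) (true-reflects (correct R full hw (i ∷ ρ)) (φ i f)) })
      (proof (forall? λ b → (b ∈ˢ? proj₂ (run∀ P ρ w)) →-dec (acc R (proj₂ b) ≟ᵇ true)))

  -- Recognising the axioms and the event condition

  UniqueEvents : Program → History → Set
  UniqueEvents P w = Unique (events w)

  quantifierFree : ∀ {H k} {φ : Formula k} → (∀ {P w} → H P w → UniqueEvents P w) → QF φ →
    Recogniser H k (λ P w ρ → Sat P (Lin (events w)) ρ φ)
  quantifierFree u qf-tt = constant λ _ _ _ → ofʸ tt
  quantifierFree u qf-ff = constant λ _ _ _ → ofⁿ id
  -- Reads of different cores are ordered too, so the recorded cores must be compared as well.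
  quantifierFree u (qf-po {x} {y}) = equivalent
    (λ {P} {w} full _ ρ →
      (λ (e , r) → let same = sameCore P ρ e in
        same , precedes-reads⇒< w (subst (λ c → Precedes (reads w) (c , _) _) same r)) ,
      (λ (e , lt) → sameCore⁻ P ρ e ,
        subst (λ c → Precedes (reads w) (c , _) (proj₁ (vlookup ρ y))) (sym e)
          (<⇒precedes-reads w lt (full⇒isRead full (vlookup ρ y)))))
    (attributes-recogniser (λ v → does (proj₁ (vlookup v x) ≟ᶠ proj₁ (vlookup v y)))
      and precedes-recogniser newRead (λ ρ → proj₁ (vlookup ρ x)) (λ ρ → proj₁ (vlookup ρ y))
            (testRead x) (testRead y) (testRead-reflects x) (testRead-reflects y))
    where
    attribute : ∀ P ρ z → proj₁ (vlookup (attributes P ρ) z) ≡ core (proj₁ (vlookup ρ z))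
    attribute P ρ z = cong proj₁ (lookup-map z (λ i → core (proj₁ i) , opOf P i) ρ)
    sameCore : ∀ P ρ → does (proj₁ (vlookup (attributes P ρ) x) ≟ᶠ proj₁ (vlookup (attributes P ρ) y)) ≡ true →
      core (proj₁ (vlookup ρ x)) ≡ core (proj₁ (vlookup ρ y))
    sameCore P ρ e = trans (sym (attribute P ρ x)) (trans (reflects-true (proof (_ ≟ᶠ _)) e) (attribute P ρ y))
    sameCore⁻ : ∀ P ρ → core (proj₁ (vlookup ρ x)) ≡ core (proj₁ (vlookup ρ y)) →
      does (proj₁ (vlookup (attributes P ρ) x) ≟ᶠ proj₁ (vlookup (attributes P ρ) y)) ≡ true
    sameCore⁻ P ρ e = dec-true (_ ≟ᶠ _) (trans (attribute P ρ x) (trans e (sym (attribute P ρ y))))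
  quantifierFree u (qf-pred {m} {f} {xs}) = equivalent
    (λ {P} _ _ ρ → trans (cong f (ops P ρ)) , trans (cong f (sym (ops P ρ))))
    (attributes-recogniser (λ v → f (vmap (λ x → proj₂ (vlookup v x)) xs)))
    where
    ops : ∀ P ρ → vmap (λ x → opOf P (vlookup ρ x)) xs ≡ vmap (λ x → proj₂ (vlookup (attributes P ρ) x)) xs
    ops P ρ = map-cong (λ x → cong proj₂ (sym (lookup-map x (λ i → core (proj₁ i) , opOf P i) ρ))) xs
  quantifierFree u (qf-hb {x} {a} {y} {b}) = equivalent
    (λ {P} {w} _ h _ → precedes⇒hb (events w) , hb⇒precedes (u {P} {w} h))
    (precedes-recogniser newEvent (λ ρ → proj₁ (vlookup ρ x) , a) (λ ρ → proj₁ (vlookup ρ y) , b)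
      (testEvent x a) (testEvent y b) (testEvent-reflects x a) (testEvent-reflects y b))
  quantifierFree u (qf-¬ p)   = complement (quantifierFree u p)
  quantifierFree u (qf-∧ p q) = combination _×-reflects_ (quantifierFree u p) (quantifierFree u q)
  quantifierFree u (qf-∨ p q) = combination _⊎-reflects_ (quantifierFree u p) (quantifierFree u q)
  quantifierFree u (qf-⇒ p q) = combination _→-reflects_ (quantifierFree u p) (quantifierFree u q)

  universal : ∀ {H k} {φ : Formula k} → (∀ {P w} → H P w → UniqueEvents P w) → UniversalF φ →
    Recogniser H k (λ P w ρ → Sat P (Lin (events w)) ρ φ)
  universal u (u-qf p)  = quantifierFree u p
  universal u (u-all p) = forAll (universal u p)

  -- Freshness is vacuous for the empty assignment; it is there to give the formula the shape that
  -- `forAll` produces. Stages are few, so a finite conjunction handles them.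
  EmittedOnce : Property 0
  EmittedOnce P w ρ = (i : Instr P) → Fresh {P} i ρ → All (λ st →
    let e = proj₁ i , st in Occurs (events w) e × ¬ Precedes (events w) e e) (allFin s)

  emittedOnce : Recogniser (λ _ _ → ⊤) 0 EmittedOnce
  emittedOnce = forAll (all (All.universal (λ st →
    let event : ∀ {P} → Vec (Instr P) 1 → REvent
        event ρ = proj₁ (vlookup ρ zero) , st
        r = testEvent-reflects zero st
    in occurs-recogniser newEvent (λ {P} → event {P}) (λ {P} → event {P})
         (testEvent zero st) (testEvent zero st) r r
       and complement (precedes-recogniser newEvent (λ {P} → event {P}) (λ {P} → event {P})
         (testEvent zero st) (testEvent zero st) r r))
    (allFin s)))

  -- Emission is confined to the window, and the window to the part of the stream already read.
  events-valid : ∀ {P w} → WF P w → All (ValidE P) (events w)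
  events-valid [] = []
  events-valid (read _ _ wf) = Allₚ.++⁺ (events-valid wf) []
  events-valid {w = emit c _ _ ∷ _} (emit lt wf) =
    Allₚ.++⁺ (events-valid wf) (ℕₚ.<-≤-trans lt (pos≤length wf c) ∷ [])
  events-valid (drop _ wf) = Allₚ.++⁺ (events-valid wf) []

  emittedOnce⇒lists : ∀ {P w} → Full P w → EmittedOnce P w [] → ListsEvents P (events w)
  emittedOnce⇒lists {P} {w} (wf , _) once =
    ¬precedes⇒unique (events w) (λ { (i , st) p@(_ , _ , _ , at , _) →
      proj₂ (onceAt (i , st) (All.lookup valid (At⇒∈ (events w) at))) p }) ,
    valid ,
    λ e v → let k , at = proj₁ (onceAt e v) in At⇒∈ (events w) at
    where
    valid = events-valid wf
    onceAt : ∀ e → ValidE P e → Occurs (events w) e × ¬ Precedes (events w) e e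
    onceAt (i , st) v = All.lookup (once (i , v) VAll.[]) (∈-allFin st)

  lists⇒emittedOnce : ∀ {P w} → ListsEvents P (events w) → EmittedOnce P w []
  lists⇒emittedOnce (u , _ , complete) (i , v) _ =
    All.universal (λ st → ∈⇒occurs (complete (i , st) v) , unique⇒¬precedes u) (allFin s)

  Specification : Axioms → Property 0
  Specification A P w ρ = EmittedOnce P w ρ × All (Sat P (Lin (events w)) ρ) A

  specification : ∀ {A} → Universal A → Recogniser (λ _ _ → ⊤) 0 (Specification A)
  specification uA = emittedOnce andThen
    all (All.map (universal λ (full , once) → proj₁ (emittedOnce⇒lists full once)) uA)

  -- The operational model

  module _ {Φ : Property 0} (R : Recogniser (λ _ _ → ⊤) 0 Φ) where

    -- nothing is the final state; the other states pair the window lengths with a state of R.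
    ModelState : Set
    ModelState = Maybe (Vec (Fin (suc t)) n × State (automaton R))

    finiteModelState : Finite ModelState
    finiteModelState = finite-Maybe (finite-× (finite-Vec n finite-Fin) (finite R))

    -- The remainder only serves to land in `Fin (suc t)`; on well-formed histories lengths lie
    -- between 0 and `t`, and it changes nothing.
    resize : Vec (Fin (suc t)) n → Core → (ℕ → ℕ) → Vec (Fin (suc t)) n
    resize ls c f = ls [ c ]≔ (f (toℕ (vlookup ls c)) mod suc t)

    atEnd? : (hd : Heads) → Dec (∀ c → hd c ≡ nothing)
    atEnd? hd = all? λ c → Maybeₚ.≡-dec _≟ᶠ_ (hd c) nothing

    -- `nop` is reserved for acceptance. Dropping is allowed in slot zero only, which keeps windows
    -- intervals of labels. The ends of tapes, the capacity and empty slots are policed by `Step`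
    -- itself. The final state has no transitions, so it is trivially absorbing.
    next : ModelState → Heads → Action t → Maybe ModelState
    next nothing         hd _             = nothing
    next (just (ls , q)) hd (move c)      =
      just (just (resize ls c suc , δ (automaton R) q (read c (hd c) (toℕ (vlookup ls c)) , [])))
    next (just (ls , q)) hd nop           = if does (atEnd? hd) ∧ acc R q then just nothing else nothing
    next (just (ls , q)) hd (emit c k st) = just (just (ls , δ (automaton R) q (emit c (toℕ k) st , [])))
    next (just (ls , q)) hd (dropI c zero) =
      just (just (resize ls c predℕ , δ (automaton R) q (drop c , [])))
    next (just (ls , q)) hd (dropI c (suc _)) = nothing

    next? : ∀ q hd a q' → Dec (next q hd a ≡ just q')
    next? q hd a q' = Maybeₚ.≡-dec (Finite._≟_ finiteModelState) (next q hd a) (just q')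

    model : OpModel
    model = record
      { nQ        = size finiteModelState
      ; h         = t
      ; Δ         = λ q hd a q' → does (next? (decode finiteModelState q) hd a (decode finiteModelState q'))
      ; qinit     = code finiteModelState (just (replicate n zero , start (automaton R)))
      ; qfinal    = code finiteModelState nothing
      ; absorbing = λ _ _ _ ()
      }

    open OpModel model using (nQ; qinit; qfinal; Δ)

    Δ⇒next : ∀ q hd a q' → Δ q hd a q' ≡ true →
      next (decode finiteModelState q) hd a ≡ just (decode finiteModelState q')
    Δ⇒next q hd a q' = reflects-true (proof (next? (decode finiteModelState q) hd a (decode finiteModelState q')))

    next⇒Δ : ∀ q hd a {m} → next (decode finiteModelState q) hd a ≡ just m →
      Δ q hd a (code finiteModelState m) ≡ true
    next⇒Δ q hd a {m} e = dec-true
      (next? (decode finiteModelState q) hd a (decode finiteModelState (code finiteModelState m)))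
      (trans e (cong just (sym (decode-code finiteModelState m))))

    toℕ-resize : ∀ ls c f → f (toℕ (vlookup ls c)) ≤ t → ∀ c' →
      toℕ (vlookup (resize ls c f) c') ≡ upd (toℕ ∘ vlookup ls) c f c'
    toℕ-resize ls c f le c' with c' ≟ᶠ c
    ... | no ¬p = cong toℕ (lookup∘update′ ¬p ls _)
    ... | yes refl = trans (cong toℕ (lookup∘update c ls _))
                       (trans (toℕ-fromℕ< _) (m<n⇒m%n≡m (s≤s le)))

    Lengths : Vec (Fin (suc t)) n → History → Set
    Lengths ls w = ∀ c → toℕ (vlookup ls c) ≡ pos w c ∸ low w c

    length≤t : ∀ {P w} → WF P w → ∀ c → pos w c ∸ low w c ≤ t
    length≤t {w = w} wf c = ℕₚ.m≤n+o⇒m∸n≤o (pos w c) (low w c) (pos≤low+t wf c)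

    lengths-read : ∀ {P w c} ls → WF P (read c ∷ w) → Lengths ls w → Lengths (resize ls c suc) (read c ∷ w)
    lengths-read {w = w} {c} ls wf'@(read lt lt' wf) len c' = trans (toℕ-resize ls c suc le c') lemma
      where
      le : suc (toℕ (vlookup ls c)) ≤ t
      le = subst (_≤ t) (trans (cong (_∸ low w c) (upd-≡ (pos w) c suc))
             (trans (ℕₚ.+-∸-assoc 1 (low≤pos wf c)) (cong suc (sym (len c))))) (length≤t wf' c)
      lemma : upd (toℕ ∘ vlookup ls) c suc c' ≡ upd (pos w) c suc c' ∸ low w c'
      lemma with c' ≟ᶠ c
      ... | yes refl = trans (cong suc (len c)) (sym (ℕₚ.+-∸-assoc 1 (low≤pos wf c)))
      ... | no _     = len c'

    lengths-drop : ∀ {P w c} ls → WF P (drop c ∷ w) → Lengths ls w → Lengths (resize ls c predℕ) (drop c ∷ w)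
    lengths-drop {w = w} {c} ls (drop lt wf) len c' = trans (toℕ-resize ls c predℕ le c') lemma
      where
      le : predℕ (toℕ (vlookup ls c)) ≤ t
      le = ℕₚ.≤-trans (ℕₚ.pred[n]≤n) (ℕₚ.≤-trans (ℕₚ.≤-reflexive (len c)) (length≤t wf c))
      lemma : upd (toℕ ∘ vlookup ls) c predℕ c' ≡ pos w c' ∸ upd (low w) c suc c'
      lemma with c' ≟ᶠ c
      ... | yes refl = trans (cong predℕ (len c)) (ℕₚ.pred[m∸n]≡m∸[1+n] (pos w c) (low w c))
      ... | no _     = len c'

    -- Runs of the model and accepted histories

    module _ (P : Program) where
      open Run model P hiding (heads)

      window : ℕ → ℕ → List ℕ
      window l zero    = []
      window l (suc m) = l ∷ window (suc l) m

      window-∷ʳ : ∀ l m → window l m ++ (l + m) ∷ [] ≡ window l (suc m)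
      window-∷ʳ l zero    = cong (_∷ []) (ℕₚ.+-identityʳ l)
      window-∷ʳ l (suc m) = cong (l ∷_)
        (trans (cong (λ x → window (suc l) m ++ x ∷ []) (ℕₚ.+-suc l m)) (window-∷ʳ (suc l) m))

      length-window : ∀ l m → length (window l m) ≡ m
      length-window l zero    = refl
      length-window l (suc m) = cong suc (length-window (suc l) m)

      At-window⁺ : ∀ l m {k} → k < m → At (window l m) k (l + k)
      At-window⁺ l (suc m) {zero}  lt       = cong just (sym (ℕₚ.+-identityʳ l))
      At-window⁺ l (suc m) {suc k} (s≤s lt) rewrite ℕₚ.+-suc l k = At-window⁺ (suc l) m lt

      At-window⁻ : ∀ l m {k j} → At (window l m) k j → k < m × j ≡ l + k
      At-window⁻ l (suc m) {zero}  refl = z<s , sym (ℕₚ.+-identityʳ l)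
      At-window⁻ l (suc m) {suc k} at   =
        let lt , e = At-window⁻ (suc l) m {k} at in s<s lt , trans e (sym (ℕₚ.+-suc l k))

      retained : History → Core → List ℕ
      retained []               = λ _ → []
      retained (read c ∷ w)     = upd (retained w) c (λ l → l ++ pos w c ∷ [])
      retained (emit _ _ _ ∷ w) = retained w
      retained (drop c ∷ w)     = upd (retained w) c (λ l → removeAt l 0)

      retained≡window : ∀ {w} → WF P w → ∀ c → retained w c ≡ window (low w c) (pos w c ∸ low w c)
      retained≡window [] c = refl
      retained≡window (emit _ wf) c = retained≡window wf c
      retained≡window {read c' ∷ w} (read _ _ wf) c with c ≟ᶠ c'
      ... | no _ = retained≡window wf c
      ... | yes refl = begin
        retained w c ++ pos w c ∷ []
          ≡⟨ cong₂ (λ l p → l ++ p ∷ []) (retained≡window wf c) (sym (ℕₚ.m+[n∸m]≡n (low≤pos wf c))) ⟩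
        window (low w c) (pos w c ∸ low w c) ++ (low w c + (pos w c ∸ low w c)) ∷ []
          ≡⟨ window-∷ʳ (low w c) (pos w c ∸ low w c) ⟩
        window (low w c) (suc (pos w c ∸ low w c))
          ≡⟨ cong (window (low w c)) (ℕₚ.+-∸-assoc 1 (low≤pos wf c)) ⟨
        window (low w c) (suc (pos w c) ∸ low w c) ∎
        where open ≡-Reasoning
      retained≡window {drop c' ∷ w} (drop lt wf) c with c ≟ᶠ c'
      ... | no _ = retained≡window wf c
      ... | yes refl rewrite retained≡window wf c | ℕₚ.+-∸-assoc 1 lt = refl

      config : Fin nQ → History → Config
      config q w = cfg q (pos w) (retained w)

      heads : History → Heads
      heads w c = P c !? pos w c

      Represents : History → Fin nQ → Set
      Represents w q = ∃ λ ls → Lengths ls w × decode finiteModelState q ≡ just (ls , run R P [] w)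

      next-read : ∀ ls w c → Lengths ls w → next (just (ls , run R P [] w)) (heads w) (move c) ≡
        just (just (resize ls c suc , run R P [] (read c ∷ w)))
      next-read ls w c len =
        cong (λ l → just (just (resize ls c suc , δ (automaton R) (run R P [] w) (read c (heads w c) l , [])))) (len c)

      ¬Δ-final : ∀ {q hd a q'} → decode finiteModelState q ≡ nothing → ¬ Δ q hd a q' ≡ true
      ¬Δ-final {q} {hd} {a} {q'} e d with Δ⇒next q hd a q' d
      ... | e' rewrite e with () ← e'

      ¬step-final : ∀ {C m C'} → decode finiteModelState (Config.state C) ≡ nothing → ¬ Step C m C'
      ¬step-final e (st-move _ _ d _ _)   = ¬Δ-final e d
      ¬step-final e (st-nop _ d)          = ¬Δ-final e d
      ¬step-final e (st-emit _ _ _ _ _ d _) = ¬Δ-final e d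
      ¬step-final e (st-drop _ _ _ _ d _) = ¬Δ-final e d

      steps-final : ∀ {C σ C'} → decode finiteModelState (Config.state C) ≡ nothing → Steps C σ C' → σ ≡ []
      steps-final e done          = refl
      steps-final e (silent st _)  = contradiction st (¬step-final e)
      steps-final e (emitted st _) = contradiction st (¬step-final e)

      !?-nothing : ∀ (xs : List Op) {j} → xs !? j ≡ nothing → length xs ≤ j
      !?-nothing []       _         = z≤n
      !?-nothing (x ∷ xs) {suc j} e = s≤s (!?-nothing xs e)

      !?-length : ∀ (xs : List Op) {j} → j ≡ length xs → xs !? j ≡ nothing
      !?-length []       refl = refl
      !?-length (x ∷ xs) refl = !?-length xs refl

      Accepted : List REvent → Set
      Accepted σ = ∃ λ w → events w ≡ σ × Full P w × acc R (run R P [] w) ≡ true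

      if-just : ∀ {A : Set} {b b'} {x m : A} → (if b ∧ b' then just x else nothing) ≡ just m →
        b ≡ true × b' ≡ true × m ≡ x
      if-just {b = true} {true} refl = refl , refl , refl

      next-nop⁻ : ∀ ls w m → next (just (ls , run R P [] w)) (heads w) nop ≡ just m →
        m ≡ nothing × (∀ c → heads w c ≡ nothing) × acc R (run R P [] w) ≡ true
      next-nop⁻ ls w m e with if-just {b = does (atEnd? (heads w))} e
      ... | end , ok , refl = refl , reflects-true (proof (atEnd? (heads w))) end , ok

      next-nop⁺ : ∀ ls w → Full P w → acc R (run R P [] w) ≡ true →
        next (just (ls , run R P [] w)) (heads w) nop ≡ just nothing
      next-nop⁺ ls w (_ , full) e
        rewrite dec-true (atEnd? (heads w)) (λ c → !?-length (P c) (full c)) | e = refl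

      At-retained⁻ : ∀ {w c k j} → WF P w → At (retained w c) k j → low w c + k < pos w c × j ≡ low w c + k
      At-retained⁻ {w} {c} {k} wf at with At-window⁻ (low w c) (pos w c ∸ low w c) {k}
                                            (subst (λ l → At l k _) (retained≡window wf c) at)
      ... | lt , e = subst (low w c + k <_) (ℕₚ.m+[n∸m]≡n (low≤pos wf c)) (ℕₚ.+-monoʳ-< (low w c) lt) , e

      At-retained⁺ : ∀ {w c k} → WF P w → low w c + k < pos w c → At (retained w c) k (low w c + k)
      At-retained⁺ {w} {c} {k} wf lt = subst (λ l → At l k _) (sym (retained≡window wf c))
        (At-window⁺ (low w c) (pos w c ∸ low w c)
          (ℕₚ.+-cancelˡ-< (low w c) _ _ (subst (low w c + k <_) (sym (ℕₚ.m+[n∸m]≡n (low≤pos wf c))) lt)))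

      length-retained : ∀ {w} c → WF P w → length (retained w c) ≡ pos w c ∸ low w c
      length-retained {w} c wf = trans (cong length (retained≡window wf c)) (length-window (low w c) _)

      next-at : ∀ w {q ls} hd a q' → decode finiteModelState q ≡ just (ls , run R P [] w) → Δ q hd a q' ≡ true →
        next (just (ls , run R P [] w)) hd a ≡ just (decode finiteModelState q')
      next-at w {q} hd a q' e d = subst (λ x → next x hd a ≡ _) e (Δ⇒next q hd a q' d)

      -- Induction on the remaining steps, with the history so far as accumulator. A `nop` can only
      -- lead to the final state, after which `steps-final` excludes further events.
      accepted : ∀ {σ C' q} w → WF P w → Represents w q → Steps (config q w) σ C' →
        Config.state C' ≡ qfinal → Accepted (events w ++ σ)
      accepted w wf (ls , _ , e) done refl with () ← e
      accepted w wf (ls , len , e) (silent (st-move c q' d lt le) rest) fin =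
        subst (λ τ → Accepted (τ ++ _)) (++-identityʳ (events w))
          (accepted (read c ∷ w) wf' (resize ls c suc , lengths-read ls wf' len ,
             just-injective (trans (sym (next-at w (heads w) (move c) q' e d)) (next-read ls w c len))) rest fin)
        where
        wf' : WF P (read c ∷ w)
        wf' = read lt (subst (_< low w c + t) (ℕₚ.m+[n∸m]≡n (low≤pos wf c))
                (ℕₚ.+-monoʳ-< (low w c) (subst (_< t) (length-retained c wf) le))) wf
      accepted w wf (ls , len , e) (silent (st-nop q' d) rest) fin
        with next-nop⁻ ls w _ (next-at w (heads w) nop q' e d)
      ... | e' , end , ok with refl ← steps-final e' rest =
        w , sym (++-identityʳ (events w)) ,
        (wf , λ c → ℕₚ.≤-antisym (pos≤length wf c) (!?-nothing (P c) (end c))) , ok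
      accepted w wf (ls , len , e) (silent (st-drop c zero j q' d at) rest) fin =
        subst (λ τ → Accepted (τ ++ _)) (++-identityʳ (events w))
          (accepted (drop c ∷ w) wf' (resize ls c predℕ , lengths-drop ls wf' len ,
             just-injective (sym (next-at w (heads w) (dropI c zero) q' e d))) rest fin)
        where
        wf' : WF P (drop c ∷ w)
        wf' = drop (subst (_< pos w c) (ℕₚ.+-identityʳ (low w c)) (proj₁ (At-retained⁻ {k = 0} wf at))) wf
      accepted w wf (ls , len , e) (silent (st-drop c (suc k) j q' d at) rest) fin
        with () ← next-at w (heads w) (dropI c (suc k)) q' e d
      accepted w wf (ls , len , e) (emitted {σ = σ} (st-emit c k st j q' d at) rest) fin
        with At-retained⁻ {k = toℕ k} wf at
      ... | lt , refl = subst Accepted (++-assoc (events w) _ σ)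
        (accepted (emit c (toℕ k) st ∷ w) (emit lt wf)
          (ls , len , just-injective (sym (next-at w (heads w) (emit c k st) q' e d))) rest fin)

      init-represents : Represents [] qinit
      init-represents = replicate n zero , (λ c → cong toℕ (lookup-replicate c zero)) ,
        decode-code finiteModelState _

      trace⇒accepted : ∀ {σ} → Traces model P σ → Accepted σ
      trace⇒accepted (C , steps , fin) = accepted [] [] init-represents steps fin

      steps-∷ʳ : ∀ {C σ C' m C''} → Steps C σ C' → Step C' m C'' → Steps C (σ ++ fromMaybe m) C''
      steps-∷ʳ {m = nothing} done st = silent st done
      steps-∷ʳ {m = just _}  done st = emitted st done
      steps-∷ʳ (silent st' r)  st = silent st' (steps-∷ʳ r st)
      steps-∷ʳ (emitted st' r) st = emitted st' (steps-∷ʳ r st)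

      Reachable : History → Set
      Reachable w = ∃ λ q → Represents w q × Steps init (events w) (config q w)

      fires : ∀ {w q ls m} a → decode finiteModelState q ≡ just (ls , run R P [] w) →
        next (just (ls , run R P [] w)) (heads w) a ≡ just m → Δ q (heads w) a (code finiteModelState m) ≡ true
      fires {w} {q} a e e' = next⇒Δ q (heads w) a (trans (cong (λ x → next x (heads w) a) e) e')

      reachable : ∀ {w} → WF P w → Reachable w
      reachable [] = qinit , init-represents , done
      reachable {read c ∷ w} wf'@(read lt lt' wf) with reachable wf
      ... | q , (ls , len , e) , steps =
        code finiteModelState (just (resize ls c suc , run R P [] (read c ∷ w))) ,
        (resize ls c suc , lengths-read ls wf' len , decode-code finiteModelState _) ,
        steps-∷ʳ steps (st-move c _ (fires {w} (move c) e (next-read ls w c len)) lt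
          (subst (_< t) (sym (length-retained c wf)) (ℕₚ.+-cancelˡ-< (low w c) _ _
             (subst (_< low w c + t) (sym (ℕₚ.m+[n∸m]≡n (low≤pos wf c))) lt'))))
      reachable {drop c ∷ w} wf'@(drop lt wf) with reachable wf
      ... | q , (ls , len , e) , steps =
        code finiteModelState (just (resize ls c predℕ , run R P [] (drop c ∷ w))) ,
        (resize ls c predℕ , lengths-drop ls wf' len , decode-code finiteModelState _) ,
        steps-∷ʳ steps (st-drop c zero (low w c) _ (fires {w} (dropI c zero) e refl)
          (subst (At (retained w c) 0) (ℕₚ.+-identityʳ (low w c))
            (At-retained⁺ wf (subst (_< pos w c) (sym (ℕₚ.+-identityʳ (low w c))) lt))))
      reachable {emit c k st ∷ w} (emit lt wf) =
        -- Histories use natural numbers as slots, actions use `Fin t`; the capacity of the window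
        -- bounds the slot.
        subst (λ l → Reachable (emit c l st ∷ w)) (toℕ-fromℕ< k<t)
          (emit-reachable (fromℕ< k<t) (subst (λ l → low w c + l < pos w c) (sym (toℕ-fromℕ< k<t)) lt))
        where
        k<t : k < t
        k<t = ℕₚ.+-cancelˡ-< (low w c) _ _ (ℕₚ.<-≤-trans lt (pos≤low+t wf c))
        emit-reachable : (k : Fin t) → low w c + toℕ k < pos w c → Reachable (emit c (toℕ k) st ∷ w)
        emit-reachable k lt with reachable wf
        ... | q , (ls , len , e) , steps =
          code finiteModelState (just (ls , run R P [] (emit c (toℕ k) st ∷ w))) ,
          (ls , len , decode-code finiteModelState _) ,
          steps-∷ʳ steps (st-emit c k st (low w c + toℕ k) _ (fires {w} (emit c k st) e refl)
            (At-retained⁺ wf lt))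

      accepted⇒trace : ∀ {σ} → Accepted σ → Traces model P σ
      accepted⇒trace (w , refl , full@(wf , _) , ok) =
        let q , (ls , _ , e) , steps = reachable wf in
        config qfinal w ,
        subst (λ τ → Steps init τ (config qfinal w)) (++-identityʳ (events w))
          (steps-∷ʳ steps (st-nop qfinal (fires {w} nop e (next-nop⁺ ls w full ok)))) ,
        refl

  -- Scheduling a reordering bounded trace

  module _ (P : Program) where

    -- The windows are kept as large as possible.
    Tight : History → Set
    Tight w = WF P w × (∀ c → low w c ≡ pos w c ∸ t)

    ReadNext : History → Core → Set
    ReadNext w c = ∃ λ w' → Tight w' × events w' ≡ events w × (∀ c' → pos w' c' ≡ upd (pos w) c suc c')

    -- Truncated subtraction splits the cases. Below `t` the window still starts at 0 and has room;
    -- from `t` on it is full, and its oldest instruction must go first.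
    readNext : ∀ {w} c → Tight w → pos w c < length (P c) → ReadNext w c
    readNext {w} c (wf , tight) lt with t ℕₚ.≤? pos w c
    ... | no t≰pos =
      read c ∷ w , (read lt lt' wf , tight') , ++-identityʳ (events w) , λ _ → refl
      where
      pos<t : pos w c < t
      pos<t = ℕₚ.≰⇒> t≰pos
      lt' : pos w c < low w c + t
      lt' = ℕₚ.<-≤-trans pos<t (ℕₚ.m≤n+m t (low w c))
      tight' : ∀ c' → low w c' ≡ upd (pos w) c suc c' ∸ t
      tight' c' with c' ≟ᶠ c
      ... | no _     = tight c'
      ... | yes refl = trans (tight c) (trans (ℕₚ.m≤n⇒m∸n≡0 (ℕₚ.<⇒≤ pos<t)) (sym (ℕₚ.m≤n⇒m∸n≡0 pos<t)))
    ... | yes t≤pos =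
      read c ∷ drop c ∷ w , (read lt lt' (drop low<pos wf) , tight') ,
      trans (++-identityʳ _) (++-identityʳ (events w)) , λ _ → refl
      where
      low+t≡pos : low w c + t ≡ pos w c
      low+t≡pos = trans (cong (_+ t) (tight c)) (ℕₚ.m∸n+n≡m t≤pos)
      low<pos : low w c < pos w c
      low<pos = subst (low w c <_) low+t≡pos (ℕₚ.m<m+n (low w c) z<s)
      lt' : pos w c < upd (low w) c suc c + t
      lt' rewrite upd-≡ (low w) c suc = s≤s (ℕₚ.≤-reflexive (sym low+t≡pos))
      tight' : ∀ c' → upd (low w) c suc c' ≡ upd (pos w) c suc c' ∸ t
      tight' c' with c' ≟ᶠ c
      ... | no _     = tight c'
      ... | yes refl = trans (cong suc (tight c)) (sym (ℕₚ.+-∸-assoc 1 t≤pos))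

    ReadUpTo : History → Core → ℕ → Set
    ReadUpTo w c m = ∃ λ w' → Tight w' × events w' ≡ events w × pos w' c ≡ m ×
      (∀ c' → c' ≢ c → pos w' c' ≡ pos w c')

    readUpTo : ∀ {w} c d {m} → Tight w → pos w c + d ≡ m → m ≤ length (P c) → ReadUpTo w c m
    readUpTo {w} c zero tw e le = w , tw , refl , trans (sym (ℕₚ.+-identityʳ (pos w c))) e , λ _ _ → refl
    readUpTo {w} c (suc d) {m} tw e le =
      let e' = trans (sym (ℕₚ.+-suc (pos w c) d)) e
          w₁ , tw₁ , ev₁ , pos₁ = readNext c tw
            (ℕₚ.≤-trans (subst (suc (pos w c) ≤_) e' (s≤s (ℕₚ.m≤m+n (pos w c) d))) le)
          w₂ , tw₂ , ev₂ , pos₂ , other₂ = readUpTo c d tw₁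
            (trans (cong (_+ d) (trans (pos₁ c) (upd-≡ (pos w) c suc))) e') le
      in w₂ , tw₂ , trans ev₂ ev₁ , pos₂ ,
         λ c' ne → trans (other₂ c' ne) (trans (pos₁ c') (upd-≢ (pos w) c suc ne))

    -- Acceptance needs all tapes at their ends, but a schedule driven by events may stop earlier,
    -- for instance when there are no stages.
    readAll : ∀ {w} (cs : List Core) → Tight w → ∃ λ w' → Tight w' × events w' ≡ events w ×
      (∀ c → c ∈ cs ⊎ pos w c ≡ length (P c) → pos w' c ≡ length (P c))
    readAll {w} [] tw = w , tw , refl , λ { c (inj₂ e) → e }
    readAll {w} (c ∷ cs) tw@(wf , _) =
      let w₁ , tw₁ , ev₁ , pos₁ , other₁ = readUpTo c (length (P c) ∸ pos w c) tw
            (ℕₚ.m+[n∸m]≡n (pos≤length wf c)) ℕₚ.≤-refl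
          w₂ , tw₂ , ev₂ , full₂ = readAll cs tw₁
          full₁ : ∀ c' → c' ∈ c ∷ cs ⊎ pos w c' ≡ length (P c') → c' ∈ cs ⊎ pos w₁ c' ≡ length (P c')
          full₁ = λ { c' (inj₁ (here refl)) → inj₂ pos₁
                    ; c' (inj₁ (there m))   → inj₁ m
                    ; c' (inj₂ e)           → inj₂ (case c' ≟ᶠ c of λ
                        { (yes refl) → pos₁ ; (no ne) → trans (other₁ c' ne) e }) }
      in w₂ , tw₂ , trans ev₂ ev₁ , λ c' h → full₂ c' (full₁ c' h)

    -- Every core has been read only as far as the events emitted so far require.
    Lazy : History → Set
    Lazy w = ∀ c j → pos w c ≡ suc j → ∃ λ st → Occurs (events w) ((c , j) , st)

    module _ (σ : List REvent) (valid : All (ValidE P) σ)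
      (bounded : ∀ i₁ i₂ → ValidI P i₁ → ValidI P i₂ → core i₁ ≡ core i₂ →
        ∀ k₁ k₂ → EvAt σ k₂ i₂ → EvAt σ k₁ i₁ → k₂ < k₁ → label i₂ < label i₁ + t) where

      at-valid : ∀ xs {e ys} → xs ++ e ∷ ys ≡ σ → ValidE P e
      at-valid xs refl = All.lookup valid (∈-++⁺ʳ xs (here refl))

      Extended : List REvent → REvent → Set
      Extended es e = ∃ λ w → Tight w × Lazy w × events w ≡ es ++ e ∷ []

      emitWithin : ∀ {w c j st} → Tight w → IsRead w (c , j) → low w c ≤ j →
        (∀ c' j' → pos w c' ≡ suc j' → ∃ λ st' → Occurs (events w ++ ((c , j) , st) ∷ []) ((c' , j') , st')) →
        Extended (events w) ((c , j) , st)
      emitWithin {w} {c} {j} {st} (wf , tight) r le lazy =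
        emit c (j ∸ low w c) st ∷ w ,
        (emit (subst (_< pos w c) (sym j≡) r) wf , tight) ,
        (λ c' j' e → subst (λ l → ∃ λ st' → Occurs (events w ++ ((c , l) , st) ∷ []) ((c' , j') , st'))
                       (sym j≡) (lazy c' j' e)) ,
        cong (λ l → events w ++ ((c , l) , st) ∷ []) j≡
        where
        j≡ : low w c + (j ∸ low w c) ≡ j
        j≡ = ℕₚ.m+[n∸m]≡n le

      -- Laziness survives the reading because the new event itself is the witness for core `c`, and
      -- the other heads have not moved.
      emitBeyond : ∀ {w c j st} → Tight w → Lazy w → pos w c ≤ j → j < length (P c) →
        Extended (events w) ((c , j) , st)
      emitBeyond {w} {c} {j} {st} tw lazy pos≤j lt
        with readUpTo {w} c (suc j ∸ pos w c) tw (ℕₚ.m+[n∸m]≡n (ℕₚ.m≤n⇒m≤1+n pos≤j)) lt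
      ... | w₁ , tw₁@(_ , tight₁) , ev₁ , pos₁ , other₁ =
        subst (λ es → Extended es ((c , j) , st)) ev₁
          (emitWithin tw₁ (ℕₚ.≤-reflexive (sym pos₁))
            -- As `t` is `suc r`, `suc j ∸ t` is `j ∸ r`: a window of positive size contains the
            -- instruction just read.
            (subst (_≤ j) (sym (trans (tight₁ c) (cong (_∸ t) pos₁))) (ℕₚ.m∸n≤m j r)) lazy₁)
        where
        lazy₁ : ∀ c' j' → pos w₁ c' ≡ suc j' →
          ∃ λ st' → Occurs (events w₁ ++ ((c , j) , st) ∷ []) ((c' , j') , st')
        lazy₁ c' j' e with c' ≟ᶠ c
        ... | yes refl with refl ← trans (sym pos₁) e = st , occurs-++⁺ (events w₁) (inj₂ refl)
        ... | no ne with st' , o ← lazy c' j' (trans (sym (other₁ c' ne)) e) =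
          st' , occurs-++⁺ (events w₁) {just ((c , j) , st)}
                  (inj₁ (subst (λ es → Occurs es ((c' , j') , st')) (sym ev₁) o))

      -- If the core has been read beyond j, an instruction further down its stream has been
      -- active already, so that the reordering bound applies.
      low≤label : ∀ {w c j st τ} → Tight w → Lazy w → events w ++ ((c , j) , st) ∷ τ ≡ σ →
        j < pos w c → low w c ≤ j
      low≤label {w} {c} {j} {st} {τ} (_ , tight) lazy e lt with pos w c in pos≡ | tight c
      ... | suc j₂ | low≡ with lazy c j₂ pos≡
      ...   | st₂ , k₂ , at₂ = subst (_≤ j) (sym low≡)
        (ℕₚ.m≤n+o⇒m∸n≤o (suc j₂) t (subst (j₂ <_) (ℕₚ.+-comm j t)
          (bounded (c , j) (c , j₂) (at-valid (events w) e) (All.lookup valid (At⇒∈ σ {k₂} at₂')) refl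
            (length (events w)) k₂ (st₂ , at₂') (st , at) (At-<length (events w) at₂))))
        where
        at₂' : At σ k₂ ((c , j₂) , st₂)
        at₂' = subst (λ xs → At xs k₂ ((c , j₂) , st₂)) e (At-++ˡ (events w) at₂)
        at : At σ (length (events w)) ((c , j) , st)
        at = subst (λ xs → At xs (length (events w)) ((c , j) , st))
               (trans (++-assoc (events w) (((c , j) , st) ∷ []) τ) e)
               (At-++ˡ (events w ++ ((c , j) , st) ∷ []) (At-last (events w) refl))

      emitNext : ∀ w e τ → Tight w → Lazy w → events w ++ e ∷ τ ≡ σ → Extended (events w) e
      emitNext w ((c , j) , st) τ tw lazy eq with pos w c ℕₚ.≤? j
      ... | yes pos≤j = emitBeyond tw lazy pos≤j (at-valid (events w) eq)
      ... | no pos≰j  = emitWithin tw (ℕₚ.≰⇒> pos≰j) (low≤label tw lazy eq (ℕₚ.≰⇒> pos≰j))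
        λ c' j' e → let st' , o = lazy c' j' e in st' , occurs-++⁺ (events w) {just ((c , j) , st)} (inj₁ o)

      schedule : ∀ w τ → Tight w → Lazy w → events w ++ τ ≡ σ → ∃ λ w' → Tight w' × events w' ≡ σ
      schedule w []      tw lazy eq = w , tw , trans (sym (++-identityʳ (events w))) eq
      schedule w (e ∷ τ) tw lazy eq with emitNext w e τ tw lazy eq
      ... | w' , tw' , lazy' , ev =
        schedule w' τ tw' lazy' (trans (cong (_++ τ) ev) (trans (++-assoc (events w) (e ∷ []) τ) eq))

      fullSchedule : ∃ λ w → Full P w × events w ≡ σ
      fullSchedule with schedule [] σ ([] , λ _ → refl) (λ _ _ ()) refl
      ... | w₁ , tw₁ , ev₁ with readAll (allFin n) tw₁
      ...   | w₂ , (wf₂ , _) , ev₂ , full₂ =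
        w₂ , (wf₂ , λ c → full₂ c (inj₁ (∈-allFin c))) , trans ev₂ ev₁

  -- Soundness and completeness

  Lin-isμhbGraph : ∀ {P σ} → ListsEvents P σ → IsμhbGraph P (Lin σ)
  Lin-isμhbGraph {P} {σ} (u , valid , _) =
    (λ e₁ e₂ l → let k , p , q = Lin⇒consecutive l in
      All.lookup valid (At⇒∈ σ {k} p) , All.lookup valid (At⇒∈ σ {suc k} q)) ,
    λ e c → unique⇒¬precedes u (hb⇒precedes u c)

  module _ {A : Axioms} (S : Recogniser (λ _ _ → ⊤) 0 (Specification A)) where

    -- The linear graph of the trace is itself the required model of the axioms, and the trace
    -- linearizes it.
    sound : Sound (model S) A
    sound P σ tr with trace⇒accepted S P tr
    ... | w , refl , full , ok with reflects-true (correct S {P} {w} full tt []) ok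
    ...   | once , models = Lin (events w) , Lin-isμhbGraph {P} lists , models , lists , λ _ _ h → h
      where
      lists : ListsEvents P (events w)
      lists = emittedOnce⇒lists full once

    complete : Refinable A → Complete t (model S) A
    complete refinable P E isG models σ lin@(lists@(_ , valid , _) , _) (bounded , _)
      with fullSchedule P σ valid bounded
    ... | w , full , refl = accepted⇒trace S P (w , refl , full ,
      true-reflects (correct S {P} {w} full tt [])
        (lists⇒emittedOnce {P} {w} lists , refinable P E isG models σ lin))

theorem2 : (n o s : ℕ) → let open Semantics n o s in
    (A : Axioms) → Universal A → Refinable A → Extensible A →
    (t : ℕ) → 1 ≤ t →
    Σ OpModel λ M → Sound M A × Complete t M A
theorem2 n o s A uA refinable _ (suc r) _ = model S , sound S , complete S refinable
  where
  open Synthesis n o s r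
  S = specification uA
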